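{- For any prime $p\ge 5$, we have $$\sum_{k=1}^{(p-1)/2}\frac{H_k-2H_{2k}}{(-3)^k\, k}\equiv \frac{1}{6}\left(\frac{p}{3}\right)B_{p-2}\left(\frac{1}{3}\right)\pmod{p}.$$
   Context: For a non-negative integer $k$, $H_k=\sum_{j=1}^k \frac{1}{j}$ is the $k$-th harmonic number. $\left(\frac{\cdot}{3}\right)$ denotes the Legendre symbol modulo $3$ (so $\left(\frac{a}{3}\right)=0,1,-1$ according as $a\equiv 0,1,2\pmod 3$). The Bernoulli polynomials $B_k(t)$ are defined by $\frac{xe^{tx}}{e^x-1}=\sum_{k=0}^{\infty}B_k(t)\frac{x^k}{k!}$. A congruence modulo $p$ between rational numbers is understood in the ring of rational numbers whose denominators are coprime to $p$ (i.e. the difference is $p$ times a rational number with denominator coprime to $p$). -}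

module Defs where

open import Algebra.Bundles using (CommutativeRing)
open import Data.Fin.Base using (Fin; zero; suc; toℕ)
open import Data.Integer.Base as ℤ using (ℤ; +_; -[1+_])
import Data.Integer.Properties as ℤₚ
open import Data.Nat.Base as ℕ using (ℕ; zero; suc; _∸_; _!)
open import Data.Nat.Coprimality using (Coprime)
open import Data.Nat.DivMod using (_mod_)
open import Data.Nat.Properties using (_!≢0)
open import Data.Product.Base using (∃; _×_)
open import Data.Rational.Base
  using (ℚ; NonZero; ↧ₙ_; 0ℚ; 1ℚ; _+_; _*_; _-_; _÷_; 1/_)
open import Data.Rational.Literals using (fromℤ)
open import Data.Rational.Properties
  using (+-*-commutativeRing; +-identityʳ; *-assoc; *-identityʳ; *-inverseˡ; *-inverseʳ)
open import Data.Rational.Solver using (module +-*-Solver)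
open import Relation.Binary.PropositionalEquality

open CommutativeRing +-*-commutativeRing using (+-commutativeMonoid; semiring; +-congˡ)
open import Algebra.Properties.CommutativeMonoid.Sum +-commutativeMonoid public
  using (sum-syntax; sum⁺-syntax; sum-cong-≗)
open import Algebra.Properties.Semiring.Exp semiring public using (_^_)
open ≡-Reasoning

infix 4 _≡_[mod_]

-- ↧ₙ r is the denominator of r in lowest terms, so r ranges over the rationals
-- whose denominators are coprime to p.
_≡_[mod_] : ℚ → ℚ → ℕ → Set
a ≡ b [mod p ] = ∃ λ r → Coprime (↧ₙ r) p × a - b ≡ fromℤ (+ p) * r

H : ℕ → ℚ
H k = ∑[ j < k ] (1/ fromℤ (+ suc (toℕ j)))

legendre₃ : ℕ → ℤ
legendre₃ a = symbol (a mod 3)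
  where
  symbol : Fin 3 → ℤ
  symbol zero             = + 0
  symbol (suc zero)       = + 1
  symbol (suc (suc zero)) = -[1+ 0 ]

i^n≢0 : ∀ i n .{{_ : ℤ.NonZero i}} → ℤ.NonZero (i ℤ.^ n)
i^n≢0 i zero    = _
i^n≢0 i (suc n) = ℤₚ.i*j≢0 i (i ℤ.^ n)
  where instance _ = i^n≢0 i n

fromℤ≢0 : ∀ i .{{_ : ℤ.NonZero i}} → NonZero (fromℤ i)
fromℤ≢0 (+ suc n) = _
fromℤ≢0 -[1+ n ]  = _

summand : (k : ℕ) .{{_ : ℕ.NonZero k}} → ℚ
summand k = (H k - fromℤ (+ 2) * H (2 ℕ.* k)) ÷ fromℤ d
  where
  d : ℤ
  d = -[1+ 2 ] ℤ.^ k ℤ.* + k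
  instance
    _ : NonZero (fromℤ d)
    _ = fromℤ≢0 d {{ℤₚ.i*j≢0 (-[1+ 2 ] ℤ.^ k) (+ k) {{i^n≢0 -[1+ 2 ] k}}}}

-- A formal power series over ℚ in x is its sequence of coefficients.
Series : Set
Series = ℕ → ℚ

infixl 6 _⊖_
infixl 7 _⊛_ _⊘_

one : Series
one zero    = 1ℚ
one (suc _) = 0ℚ

_⊖_ : Series → Series → Series
(f ⊖ g) n = f n - g n

_⊛_ : Series → Series → Series
(f ⊛ g) n = ∑[ i ≤ n ] (f (toℕ i) * g (n ∸ toℕ i))

-- x · f
shift : Series → Series
shift f zero    = 0ℚ
shift f (suc n) = f n

-- (f - f(0)) / x
tail : Series → Series
tail f n = f (suc n)

-- Long division: with c = f(0) / g(0), the quotient f / g is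
-- c + x · ((f - c g) / x) / g.
_⊘_ : (f g : Series) .{{_ : NonZero (g 0)}} → Series
(f ⊘ g) zero    = f 0 ÷ g 0
(f ⊘ g) (suc n) = ((λ m → f (suc m) - (f 0 ÷ g 0) * g (suc m)) ⊘ g) n

invFact : ℕ → ℚ
invFact n = (1/ fromℤ (+ (n !))) {{fromℤ≢0 (+ (n !)) {{n !≢0}}}}

-- e^{tx}
exp : ℚ → Series
exp t n = t ^ n * invFact n

-- Σ aₖ xᵏ / k!
egf : (ℕ → ℚ) → Series
egf a k = a k * invFact k

-- x e^{tx} / (e^x - 1).  The denominator has no constant term, so a factor x
-- is first cancelled from numerator and denominator.
bernoulliSeries : ℚ → Series
bernoulliSeries t = tail (shift (exp t)) ⊘ tail (exp 1ℚ ⊖ one)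

-- The value at t of the k-th Bernoulli polynomial, k! times the coefficient of
-- xᵏ; bernoulli-generating below checks the generating function.
bernoulli : ℕ → ℚ → ℚ
bernoulli k t = fromℤ (+ (k !)) * bernoulliSeries t k

⊘-⊛ : ∀ f g .{{_ : NonZero (g 0)}} → (f ⊘ g) ⊛ g ≗ f
⊘-⊛ f g zero = begin
  f 0 * 1/ g 0 * g 0 + 0ℚ    ≡⟨ +-identityʳ _ ⟩
  f 0 * 1/ g 0 * g 0         ≡⟨ *-assoc (f 0) (1/ g 0) (g 0) ⟩
  f 0 * (1/ g 0 * g 0)       ≡⟨ cong (f 0 *_) (*-inverseˡ (g 0)) ⟩
  f 0 * 1ℚ                   ≡⟨ *-identityʳ (f 0) ⟩
  f 0                        ∎
⊘-⊛ f g (suc n) = begin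
  c * g (suc n) + (r ⊘ g ⊛ g) n               ≡⟨ +-congˡ {c * g (suc n)} (⊘-⊛ r g n) ⟩
  c * g (suc n) + (f (suc n) - c * g (suc n)) ≡⟨ solve 2 (λ u v → u :+ (v :- u) := v) refl (c * g (suc n)) (f (suc n)) ⟩
  f (suc n)                                   ∎
  where
  open +-*-Solver
  c = f 0 ÷ g 0
  r : Series
  r m = f (suc m) - c * g (suc m)

egf-bernoulli : ∀ t → egf (λ k → bernoulli k t) ≗ bernoulliSeries t
egf-bernoulli t k = begin
  a * b * c    ≡⟨ solve 3 (λ u v w → u :* v :* w := v :* (u :* w)) refl a b c ⟩
  b * (a * c)  ≡⟨ cong (b *_) (*-inverseʳ a {{fromℤ≢0 (+ (k !)) {{k !≢0}}}}) ⟩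
  b * 1ℚ       ≡⟨ *-identityʳ b ⟩
  b            ∎
  where
  open +-*-Solver
  a = fromℤ (+ (k !))
  b = bernoulliSeries t k
  c = invFact k

⊛-congʳ : ∀ f {g h} → g ≗ h → f ⊛ g ≗ f ⊛ h
⊛-congʳ f g≗h n = sum-cong-≗ {suc n} λ i → cong (f (toℕ i) *_) (g≗h (n ∸ toℕ i))

⊛-congˡ : ∀ {f g} h → f ≗ g → f ⊛ h ≗ g ⊛ h
⊛-congˡ h f≗g n = sum-cong-≗ {suc n} λ i → cong (_* h (n ∸ toℕ i)) (f≗g (toℕ i))

⊛-shift : ∀ f g → f ⊛ shift g ≗ shift (f ⊛ g)
⊛-shift f g zero          = solve 1 (λ u → u :* con 0ℚ :+ con 0ℚ := con 0ℚ) refl (f 0)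
  where open +-*-Solver
⊛-shift f g (suc zero)    = +-congˡ {f 0 * g zero} (⊛-shift (tail f) g zero)
⊛-shift f g (suc (suc n)) = +-congˡ {f 0 * g (suc n)} (⊛-shift (tail f) g (suc n))

shift-cong : ∀ {f g} → f ≗ g → shift f ≗ shift g
shift-cong f≗g zero    = refl
shift-cong f≗g (suc n) = f≗g n

shift-tail : ∀ {f} → f 0 ≡ 0ℚ → f ≗ shift (tail f)
shift-tail f₀≡0 zero    = f₀≡0
shift-tail f₀≡0 (suc n) = refl

-- The generating function (Σ Bₖ(t) xᵏ/k!) · (e^x - 1) = x e^{tx}.
bernoulli-generating : ∀ t →
  egf (λ k → bernoulli k t) ⊛ (exp 1ℚ ⊖ one) ≗ shift (exp t)
bernoulli-generating t n = begin
  (egf (λ k → bernoulli k t) ⊛ e) n ≡⟨ ⊛-congˡ e (egf-bernoulli t) n ⟩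
  (b ⊛ e) n                         ≡⟨ ⊛-congʳ b (shift-tail {e} refl) n ⟩
  (b ⊛ shift (tail e)) n            ≡⟨ ⊛-shift b (tail e) n ⟩
  shift (b ⊛ tail e) n              ≡⟨ shift-cong (⊘-⊛ (exp t) (tail e)) n ⟩
  shift (exp t) n                   ∎
  where
  e = exp 1ℚ ⊖ one
  b = bernoulliSeries t

{-# OPTIONS --safe #-}
-- Since H k - 2 H (2 k) = - 2 O k with O k = Σ_{j ≤ k} 1 / (2 j - 1), the left side is
-- the value at x² = - 1/3 of A = - 2 Σ O k x²ᵏ / k.  Let D = (1 - x²) d/dx.  Modulo p,
-- D multiplies gₖ = (1 + x)ᵏ (1 - x)ᵖ⁻ᵏ by 2 k, so the coefficients of Σ gₖ / k² follow
-- recursively from those of Σ gₖ = xᵖ⁻¹ - 1, and comparing them gives A ≡ Σ gₖ / k².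
-- For x = - (1 + 2 ω) / 3, where ω² + ω + 1 = 0, one has 1 + x = - ω (1 - x), whence
-- A ≡ (1 - x)ᵖ L(- ω) with L(y) = Σ yᵏ / k².  The relation
--   L(y²) ≡ 2 (1 + yᵖ) L(y) + 2 (1 - yᵖ) L(- y)
-- turns this into - ωᵖ L(ω), and sorting the terms by k mod 3 into
-- S / 3 with S = Σ_{k ≤ p/3} 1 / k².
-- On the other side, k ↦ Bₚ₋₂(k) has differences (p - 2) kᵖ⁻³ ≡ - 2 / k² and Bₚ₋₂(0) = 0,
-- so Bₚ₋₂(⌊p/3⌋ + 1) ≡ - 2 S; here ⌊p/3⌋ + 1 is congruent to 1/3 or to 2/3 = 1 - 1/3
-- and the reflection formula for Bernoulli polynomials applies.
module Submission where

open import Algebra.Bundles using (AbelianGroup; CommutativeRing; RawRing)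
import Algebra.Construct.DirectProduct as DirectProduct
open import Algebra.Solver.Ring.AlmostCommutativeRing
  using (fromCommutativeRing; _-Raw-AlmostCommutative⟶_)
open import Data.Fin.Base using (toℕ)
open import Data.Maybe.Base using (Maybe; just; nothing)
open import Data.Nat.Base as ℕ
  using (ℕ; zero; suc; _∸_; _<_; _≤_; _!; _/_; s≤s; z≤n)
import Data.Nat.Properties as ℕₚ
open import Data.Product.Base using (Σ; _×_; _,_; proj₁; proj₂)
open import Relation.Binary.PropositionalEquality as ≡ using (_≡_)
open import Relation.Nullary using (yes; no)

-- A square root x of -1/3 lies in ℤ/p only for p ≡ 1 mod 3. Hence ω is adjoined formally, as pairs
-- over ℤ/p, and the argument is written for any commutative ring in which p = 0 and 1, ..., p - 1
-- have given inverses. The extension has zero divisors when p ≡ 1 mod 3, so every cancellation goes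
-- through an explicit inverse; an equality between embedded elements is read off in the first
-- component. D acts on gₖ by 2 k because (1 - x²) gₖ′ = (k (1 - x) - (p - k) (1 + x)) gₖ = (2 k - p
-- - p x) gₖ. The value of Σ gₖ comes from 2 x gₖ = (1 + x) gₖ - (1 - x) gₖ, which telescopes;
-- Frobenius evaluates the two ends. The constant coefficient of Σ gₖ / k² lies outside the
-- recursion: it is Σ 1 / k² = L(1), and the relation for L at y = 1 reads L(1) = 4 L(1). The odd
-- coefficients vanish because x ↦ - x exchanges gₖ and gₚ₋ₖ. Replacing ⌊p/3⌋ + 1 by 1/3 or 2/3
-- inside Bₚ₋₂ is legitimate because the generating series, up to degree p - 2, involves only 1 / j!
-- with j < p, so Bₚ₋₂ has p-integral coefficients.

-- Polynomial identities with integer coefficients in a commutative ring.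

module IntegerCoefficientSolver {c ℓ} (R : CommutativeRing c ℓ) where
  open CommutativeRing R hiding (zero)
  open import Algebra.Properties.Ring ring
  open import Relation.Binary.Reasoning.Setoid setoid
  import Algebra.Properties.Semiring.Mult.TCOptimised semiring as M
  import Algebra.Solver.Ring.NaturalCoefficients.Default commutativeSemiring as S

  num : ℕ → Carrier
  num n = n M.× 1#

  -- The coefficient (a , b) stands for the integer a - b.  It has to be reduced
  -- so that equal integers give syntactically equal normal forms.
  reduce : ℕ → ℕ → ℕ × ℕ
  reduce (suc a) (suc b) = reduce a b
  reduce a       b       = a , b

  differences : RawRing _ _
  differences = record
    { Carrier = ℕ × ℕ
    ; _≈_ = _≡_
    ; _+_ = λ { (a , b) (c , d) → reduce (a ℕ.+ c) (b ℕ.+ d) }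
    ; _*_ = λ { (a , b) (c , d) → reduce (a ℕ.* c ℕ.+ b ℕ.* d) (a ℕ.* d ℕ.+ b ℕ.* c) }
    ; -_ = λ { (a , b) → b , a }
    ; 0# = 0 , 0
    ; 1# = 1 , 0
    }

  value : ℕ × ℕ → Carrier
  value (a , zero)  = num a
  value (a , suc b) = num a - num (suc b)

  value-def : ∀ a b → value (a , b) ≈ num a - num b
  value-def a zero    = sym (trans (+-congˡ -0#≈0#) (+-identityʳ _))
  value-def a (suc b) = refl

  cancel : ∀ {x y u v} → x + v ≈ u + y → x - y ≈ u - v
  cancel {x} {y} {u} {v} eq = begin
    x - y               ≈⟨ +-congʳ (+-identityʳ x) ⟨
    x + 0# - y          ≈⟨ +-congʳ (+-congˡ (-‿inverseʳ v)) ⟨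
    x + (v - v) - y     ≈⟨ S.solve 4 (λ x v w y → x S.:+ (v S.:+ w) S.:+ y S.:= (x S.:+ v) S.:+ (w S.:+ y)) refl x v
        (- v) (- y) ⟩
    x + v + (- v - y)   ≈⟨ +-congʳ eq ⟩
    u + y + (- v - y)   ≈⟨ S.solve 4 (λ u y w z → (u S.:+ y) S.:+ (w S.:+ z) S.:= (u S.:+ w) S.:+
        (y S.:+ z)) refl u y (- v) (- y) ⟩
    u - v + (y - y)     ≈⟨ +-congˡ (-‿inverseʳ y) ⟩
    u - v + 0#          ≈⟨ +-identityʳ _ ⟩
    u - v               ∎

  value-reduce : ∀ a b → value (reduce a b) ≈ num a - num b
  value-reduce zero    zero    = value-def 0 0
  value-reduce zero    (suc b) = refl
  value-reduce (suc a) zero    = value-def (suc a) 0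
  value-reduce (suc a) (suc b) = trans (value-reduce a b) (cancel (begin
    num a + num (suc b)    ≈⟨ +-congˡ (M.1+× b 1#) ⟩
    num a + (1# + num b)   ≈⟨ S.solve 3 (λ o a b → a S.:+ (o S.:+ b) S.:= (o S.:+ a) S.:+ b) refl 1# (num a) (num b) ⟩
    1# + num a + num b     ≈⟨ +-congʳ (M.1+× a 1#) ⟨
    num (suc a) + num b    ∎))

  *-value : ∀ a b c d → (num a - num b) * (num c - num d) ≈
            num (a ℕ.* c ℕ.+ b ℕ.* d) - num (a ℕ.* d ℕ.+ b ℕ.* c)
  *-value a b c d = begin
    (num a - num b) * (num c - num d)
      ≈⟨ S.solve 4 (λ a b c d → (a S.:+ b) S.:* (c S.:+ d) S.:= a S.:* c S.:+ b S.:* d S.:+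
          (a S.:* d S.:+ b S.:* c)) refl (num a) (- num b) (num c) (- num d) ⟩
    num a * num c + - num b * - num d + (num a * - num d + - num b * num c)
      ≈⟨ +-cong (+-congˡ (trans (sym (-‿distribˡ-* _ _)) (trans (-‿cong (sym (-‿distribʳ-* _ _)))
          (-‿involutive _)))) (+-cong (sym (-‿distribʳ-* _ _)) (sym (-‿distribˡ-* _ _))) ⟩
    num a * num c + num b * num d + (- (num a * num d) - num b * num c)
      ≈⟨ +-congˡ (-‿+-comm _ _) ⟩
    num a * num c + num b * num d - (num a * num d + num b * num c)
      ≈⟨ +-cong (homo a c b d) (-‿cong (homo a d b c)) ⟨
    num (a ℕ.* c ℕ.+ b ℕ.* d) - num (a ℕ.* d ℕ.+ b ℕ.* c) ∎
    where
    homo : ∀ a c b d → num (a ℕ.* c ℕ.+ b ℕ.* d) ≈ num a * num c + num b * num d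
    homo a c b d = trans (M.×-homo-+ 1# (a ℕ.* c) (b ℕ.* d)) (+-cong (M.×1-homo-* a c) (M.×1-homo-* b d))

  morphism : differences -Raw-AlmostCommutative⟶ fromCommutativeRing R
  morphism = record
    { ⟦_⟧ = value
    ; +-homo = λ { (a , b) (c , d) → begin
        value (reduce (a ℕ.+ c) (b ℕ.+ d))      ≈⟨ value-reduce (a ℕ.+ c) (b ℕ.+ d) ⟩
        num (a ℕ.+ c) - num (b ℕ.+ d)           ≈⟨ +-cong (M.×-homo-+ 1# a c) (-‿cong (M.×-homo-+ 1# b d)) ⟩
        num a + num c - (num b + num d)         ≈⟨ +-congˡ (-‿+-comm _ _) ⟨
        num a + num c + (- num b - num d)       ≈⟨ S.solve 4 (λ a c b d → (a S.:+ c) S.:+ (b S.:+ d) S.:=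
            (a S.:+ b) S.:+ (c S.:+ d)) refl (num a) (num c) (- num b) (- num d) ⟩
        num a - num b + (num c - num d)         ≈⟨ +-cong (value-def a b) (value-def c d) ⟨
        value (a , b) + value (c , d)           ∎ }
    ; *-homo = λ { (a , b) (c , d) → trans (value-reduce (a ℕ.* c ℕ.+ b ℕ.* d) (a ℕ.* d ℕ.+ b ℕ.* c))
        (trans (sym (*-value a b c d)) (sym (*-cong (value-def a b) (value-def c d)))) }
    ; -‿homo = λ { (a , b) → begin
        value (b , a)        ≈⟨ value-def b a ⟩
        num b - num a        ≈⟨ +-comm _ _ ⟩
        - num a + num b      ≈⟨ +-congˡ (-‿involutive _) ⟨
        - num a - - num b    ≈⟨ -‿+-comm _ _ ⟩
        - (num a - num b)    ≈⟨ -‿cong (value-def a b) ⟨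
        - value (a , b)      ∎ }
    ; 0-homo = refl
    ; 1-homo = refl
    }

  value-≟ : (x y : ℕ × ℕ) → Maybe (value x ≈ value y)
  value-≟ (a , b) (c , d) with a ℕ.+ d ℕₚ.≟ c ℕ.+ b
  ... | no _   = nothing
  ... | yes eq = just (begin
    value (a , b)  ≈⟨ value-def a b ⟩
    num a - num b  ≈⟨ cancel (trans (sym (M.×-homo-+ 1# a d)) (trans
        (reflexive (≡.cong num eq)) (M.×-homo-+ 1# c b))) ⟩
    num c - num d  ≈⟨ value-def c d ⟨
    value (c , d)  ∎)

  open import Algebra.Solver.Ring differences (fromCommutativeRing R) morphism value-≟ public
    using (solve; _:+_; _:*_; _:-_; :-_; _:=_; con; Polynomial)

  :1 : ∀ {n} → Polynomial n
  :1 = con (1 , 0)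

  -- Ideal membership as a proof method: the hypotheses are relations `l ≈ r`, and the goal follows
  -- once `x - y` is written as a combination of the differences `l - r`. The cofactors `c` are the
  -- certificate; the remaining polynomial identity is left to `solve`.
  ≈-from₁ : ∀ {x y c l r} → l ≈ r → x - y ≈ c * (l - r) → x ≈ y
  ≈-from₁ l≈r eq = x∙y⁻¹≈ε⇒x≈y _ _
    (trans eq (trans (*-congˡ (x≈y⇒x∙y⁻¹≈ε l≈r)) (zeroʳ _)))

  ≈-from₂ : ∀ {x y c l r c′ l′ r′} → l ≈ r → l′ ≈ r′ →
            x - y ≈ c * (l - r) + c′ * (l′ - r′) → x ≈ y
  ≈-from₂ {c′ = c′} {l′} {r′} l≈r l′≈r′ eq = ≈-from₁ l≈r
    (trans eq (trans (+-congˡ (trans (*-congˡ (x≈y⇒x∙y⁻¹≈ε l′≈r′)) (zeroʳ c′))) (+-identityʳ _)))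

  ≈-from₃ : ∀ {x y c l r c′ l′ r′ c″ l″ r″} → l ≈ r → l′ ≈ r′ → l″ ≈ r″ →
            x - y ≈ c * (l - r) + c′ * (l′ - r′) + c″ * (l″ - r″) → x ≈ y
  ≈-from₃ {c″ = c″} l≈r l′≈r′ l″≈r″ eq = ≈-from₂ l≈r l′≈r′
    (trans eq (trans (+-congˡ (trans (*-congˡ (x≈y⇒x∙y⁻¹≈ε l″≈r″)) (zeroʳ c″))) (+-identityʳ _)))

  ≈-from₄ : ∀ {x y c l r c′ l′ r′ c″ l″ r″ c‴ l‴ r‴} → l ≈ r → l′ ≈ r′ → l″ ≈ r″ → l‴ ≈ r‴ →
            x - y ≈ c * (l - r) + c′ * (l′ - r′) + c″ * (l″ - r″) + c‴ * (l‴ - r‴) → x ≈ y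
  ≈-from₄ {c‴ = c‴} l≈r l′≈r′ l″≈r″ l‴≈r‴ eq = ≈-from₃ l≈r l′≈r′ l″≈r″
    (trans eq (trans (+-congˡ (trans (*-congˡ (x≈y⇒x∙y⁻¹≈ε l‴≈r‴)) (zeroʳ c‴))) (+-identityʳ _)))

-- Finite sums over initial segments of ℕ.

module InitialSums {c ℓ} (R : CommutativeRing c ℓ) where
  open CommutativeRing R hiding (zero)
  open import Algebra.Properties.Semiring.Sum semiring
  open import Algebra.Properties.Ring ring
  open import Relation.Binary.Reasoning.Setoid setoid
  open IntegerCoefficientSolver R

  -- Summands are functions on ℕ rather than on `Fin n`, so that splitting, reversing and reindexing
  -- are arithmetic on natural numbers.
  sum< : ℕ → (ℕ → Carrier) → Carrier
  sum< zero    f = 0#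
  sum< (suc n) f = f 0 + sum< n (λ i → f (suc i))

  sum<-∑ : ∀ n (f : ℕ → Carrier) → sum< n f ≡ ∑[ i < n ] f (toℕ i)
  sum<-∑ zero    f = ≡.refl
  sum<-∑ (suc n) f = ≡.cong (f 0 +_) (sum<-∑ n (λ i → f (suc i)))

  sum<-cong : ∀ n {f g : ℕ → Carrier} → (∀ i → i < n → f i ≈ g i) → sum< n f ≈ sum< n g
  sum<-cong zero    f≈g = refl
  sum<-cong (suc n) f≈g = +-cong (f≈g 0 (s≤s z≤n)) (sum<-cong n λ i i<n → f≈g (suc i) (s≤s i<n))

  sum<-zero : ∀ n {f : ℕ → Carrier} → (∀ i → i < n → f i ≈ 0#) → sum< n f ≈ 0#
  sum<-zero zero    f≈0 = refl
  sum<-zero (suc n) f≈0 =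
    trans (+-cong (f≈0 0 (s≤s z≤n)) (sum<-zero n λ i i<n → f≈0 (suc i) (s≤s i<n))) (+-identityˡ _)

  sum<-+ : ∀ n (f g : ℕ → Carrier) → sum< n (λ i → f i + g i) ≈ sum< n f + sum< n g
  sum<-+ n f g
    rewrite sum<-∑ n (λ i → f i + g i) | sum<-∑ n f | sum<-∑ n g = ∑-distrib-+ {n} _ _

  sum<-*ˡ : ∀ n x (f : ℕ → Carrier) → sum< n (λ i → x * f i) ≈ x * sum< n f
  sum<-*ˡ n x f rewrite sum<-∑ n (λ i → x * f i) | sum<-∑ n f = sym (*-distribˡ-sum {n} x _)

  sum<-comm : ∀ m n (f : ℕ → ℕ → Carrier) →
              sum< m (λ i → sum< n (f i)) ≈ sum< n (λ j → sum< m (λ i → f i j))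
  sum<-comm zero    n f = sym (sum<-zero n λ _ _ → refl)
  sum<-comm (suc m) n f = trans (+-congˡ (sum<-comm m n (λ i → f (suc i)))) (sym (sum<-+ n (f 0) _))

  sum<-last : ∀ n (f : ℕ → Carrier) → sum< (suc n) f ≈ sum< n f + f n
  sum<-last zero    f = +-comm _ _
  sum<-last (suc n) f = trans (+-congˡ (sum<-last n (λ i → f (suc i)))) (sym (+-assoc _ _ _))

  sum<-append : ∀ m n (f : ℕ → Carrier) → sum< (m ℕ.+ n) f ≈ sum< m f + sum< n (λ i → f (m ℕ.+ i))
  sum<-append zero    n f = sym (+-identityˡ _)
  sum<-append (suc m) n f = trans (+-congˡ (sum<-append m n (λ i → f (suc i)))) (sym (+-assoc _ _ _))

  sum<-reverse : ∀ n (f : ℕ → Carrier) → sum< n f ≈ sum< n (λ i → f (n ∸ suc i))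
  sum<-reverse zero    f = refl
  sum<-reverse (suc n) f =
    trans (sum<-last n f) (trans (+-comm _ _) (+-congˡ (sum<-reverse n f)))

  sum<-blocks : ∀ n d (f : ℕ → Carrier) →
                sum< (n ℕ.* d) f ≈ sum< n (λ i → sum< d (λ r → f (r ℕ.+ i ℕ.* d)))
  sum<-blocks zero    d f = refl
  sum<-blocks (suc n) d f = begin
    sum< (d ℕ.+ n ℕ.* d) f
      ≈⟨ sum<-append d (n ℕ.* d) f ⟩
    sum< d f + sum< (n ℕ.* d) (λ i → f (d ℕ.+ i))
      ≈⟨ +-cong (sum<-cong d λ i _ → at (≡.sym (ℕₚ.+-identityʳ i))) (sum<-blocks n d (λ i → f (d ℕ.+ i))) ⟩
    sum< d (λ r → f (r ℕ.+ 0)) + sum< n (λ i → sum< d (λ r → f (d ℕ.+ (r ℕ.+ i ℕ.* d))))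
      ≈⟨ +-congˡ (sum<-cong n λ i _ → sum<-cong d λ r _ → at (rotate d r (i ℕ.* d))) ⟩
    sum< (suc n) (λ i → sum< d (λ r → f (r ℕ.+ i ℕ.* d))) ∎
    where
    at : ∀ {i j} → i ≡ j → f i ≈ f j
    at eq = reflexive (≡.cong f eq)
    rotate : ∀ a b c → a ℕ.+ (b ℕ.+ c) ≡ b ℕ.+ (a ℕ.+ c)
    rotate a b c = ≡.trans (≡.sym (ℕₚ.+-assoc a b c))
      (≡.trans (≡.cong (ℕ._+ c) (ℕₚ.+-comm a b)) (ℕₚ.+-assoc b a c))

  sum<-evens : ∀ n {f : ℕ → Carrier} → (∀ k → f (suc (k ℕ.* 2)) ≈ 0#) →
               sum< (n ℕ.* 2) f ≈ sum< n (λ k → f (k ℕ.* 2))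
  sum<-evens zero    odd≈0 = refl
  sum<-evens (suc n) odd≈0 = +-congˡ (trans (+-cong (odd≈0 0) (sum<-evens n λ k → odd≈0 (suc k))) (+-identityˡ _))

  sum<-telescope : ∀ n (f : ℕ → Carrier) → sum< n (λ i → f (suc i) - f i) ≈ f n - f 0
  sum<-telescope zero    f = sym (-‿inverseʳ _)
  sum<-telescope (suc n) f = begin
    f 1 - f 0 + sum< n (λ i → f (suc (suc i)) - f (suc i)) ≈⟨ +-congˡ (sum<-telescope n (λ i → f (suc i))) ⟩
    f 1 - f 0 + (f (suc n) - f 1)                          ≈⟨ solve 3 (λ x y z → x :- y :+ (z :- x) := z :- y)
        refl (f 1) (f 0) (f (suc n)) ⟩
    f (suc n) - f 0                                        ∎

-- Coefficients of (1 + x)ⁱ (1 - x)ʲ in an arbitrary commutative ring.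

module Expansion {c ℓ} (R : CommutativeRing c ℓ) where
  open CommutativeRing R hiding (zero)
  open import Algebra.Properties.Semiring.Mult semiring renaming (_×_ to _×′_)
  open import Algebra.Properties.Semiring.Exp semiring
  open import Algebra.Properties.Ring ring
  open import Relation.Binary.Reasoning.Setoid setoid
  open IntegerCoefficientSolver R
  open InitialSums R

  nat : ℕ → Carrier
  nat n = n ×′ 1#

  Seq : Set c
  Seq = ℕ → Carrier

  δ : Seq
  δ zero    = 1#
  δ (suc _) = 0#

  infix 4 _≋_
  _≋_ : Seq → Seq → Set ℓ
  f ≋ g = ∀ m → f m ≈ g m

  -- Multiplication by 1 + a x of the polynomial with coefficients f.
  mul : Carrier → Seq → Seq
  mul a f zero    = f zero
  mul a f (suc m) = f (suc m) + a * f m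

  mul^ : Carrier → ℕ → Seq → Seq
  mul^ a zero    f = f
  mul^ a (suc i) f = mul a (mul^ a i f)

  -- The coefficients of (1 + x)ⁱ (1 - x)ʲ.
  K : ℕ → ℕ → Seq
  K i j = mul^ 1# i (mul^ (- 1#) j δ)

  mul-cong : ∀ a {f g} → f ≋ g → mul a f ≋ mul a g
  mul-cong a f≋g zero    = f≋g zero
  mul-cong a f≋g (suc m) = +-cong (f≋g (suc m)) (*-congˡ (f≋g m))

  mul-comm : ∀ a b f → mul a (mul b f) ≋ mul b (mul a f)
  mul-comm a b f zero          = refl
  mul-comm a b f (suc zero)    = solve 4 (λ a b f₁ f₀ →
    f₁ :+ b :* f₀ :+ a :* f₀ := f₁ :+ a :* f₀ :+ b :* f₀) refl a b (f 1) (f 0)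
  mul-comm a b f (suc (suc m)) = solve 5 (λ a b f₂ f₁ f₀ →
    f₂ :+ b :* f₁ :+ a :* (f₁ :+ b :* f₀) := f₂ :+ a :* f₁ :+ b :* (f₁ :+ a :* f₀))
    refl a b (f (2 ℕ.+ m)) (f (1 ℕ.+ m)) (f m)

  mul^-cong : ∀ a i {f g} → f ≋ g → mul^ a i f ≋ mul^ a i g
  mul^-cong a zero    f≋g = f≋g
  mul^-cong a (suc i) f≋g = mul-cong a (mul^-cong a i f≋g)

  mul^-mul : ∀ a i b f → mul^ a i (mul b f) ≋ mul b (mul^ a i f)
  mul^-mul a zero    b f m = refl
  mul^-mul a (suc i) b f m = trans (mul-cong a (mul^-mul a i b f) m) (mul-comm a b _ m)

  mul^-comm : ∀ a i b j f → mul^ a i (mul^ b j f) ≋ mul^ b j (mul^ a i f)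
  mul^-comm a i b zero    f m = refl
  mul^-comm a i b (suc j) f m = trans (mul^-mul a i b (mul^ b j f) m) (mul-cong b (mul^-comm a i b j f) m)

  mul^-0 : ∀ a i f → mul^ a i f 0 ≈ f 0
  mul^-0 a zero    f = refl
  mul^-0 a (suc i) f = mul^-0 a i f

  K-0 : ∀ i j → K i j 0 ≈ 1#
  K-0 i j = trans (mul^-0 1# i _) (mul^-0 (- 1#) j δ)

  sign : ℕ → Carrier
  sign zero    = 1#
  sign (suc m) = - sign m

  alternate : Seq → Seq
  alternate f m = sign m * f m

  mul-alternate : ∀ {a b} → a + b ≈ 0# → ∀ f → mul b (alternate f) ≋ alternate (mul a f)
  mul-alternate eq f zero = refl
  mul-alternate {a} {b} eq f (suc m) = ≈-from₁ eq (solve 5 (λ a b s f₁ f₀ →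
    (:- s :* f₁ :+ b :* (s :* f₀)) :- (:- s :* (f₁ :+ a :* f₀)) := s :* f₀ :* (a :+ b :- con (0 , 0)))
    refl a b (sign m) (f (suc m)) (f m))

  mul^-alternate : ∀ {a b} → a + b ≈ 0# → ∀ i f → mul^ b i (alternate f) ≋ alternate (mul^ a i f)
  mul^-alternate eq zero    f m = refl
  mul^-alternate {b = b} eq (suc i) f m =
    trans (mul-cong b (mul^-alternate eq i f) m) (mul-alternate eq (mul^ _ i f) m)

  -- The substitution x ↦ - x exchanges the factors 1 + x and 1 - x; on coefficients it is
  -- `alternate`.
  K-flip : ∀ i j → K i j ≋ alternate (K j i)
  K-flip i j m = begin
    K i j m                                              ≈⟨ mul^-comm 1# i (- 1#) j δ m ⟩
    mul^ (- 1#) j (mul^ 1# i δ) m                        ≈⟨ mul^-cong (- 1#) j (mul^-cong 1# i δ-alternate) m ⟩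
    mul^ (- 1#) j (mul^ 1# i (alternate δ)) m            ≈⟨ mul^-cong (- 1#) j (mul^-alternate
        (-‿inverseˡ 1#) i δ) m ⟩
    mul^ (- 1#) j (alternate (mul^ (- 1#) i δ)) m        ≈⟨ mul^-alternate (-‿inverseʳ 1#) j _ m ⟩
    alternate (K j i) m                                  ∎
    where
    δ-alternate : δ ≋ alternate δ
    δ-alternate zero    = sym (*-identityˡ 1#)
    δ-alternate (suc m) = sym (zeroʳ _)

  DegreeBelow : ℕ → Seq → Set ℓ
  DegreeBelow N f = ∀ m → N ≤ m → f m ≈ 0#

  δ-degree : DegreeBelow 1 δ
  δ-degree (suc m) _ = refl

  mul-degree : ∀ {N} a {f} → DegreeBelow N f → DegreeBelow (suc N) (mul a f)
  mul-degree a d (suc m) (s≤s N≤m) =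
    trans (+-cong (d (suc m) (ℕₚ.m≤n⇒m≤1+n N≤m)) (*-congˡ (d m N≤m))) (trans (+-identityˡ _) (zeroʳ a))

  mul^-degree : ∀ {N} a i {f} → DegreeBelow N f → DegreeBelow (i ℕ.+ N) (mul^ a i f)
  mul^-degree a zero    d = d
  mul^-degree a (suc i) d = mul-degree a (mul^-degree a i d)

  -- A truncated sum, equal to the value of the polynomial only under `DegreeBelow N`; hence the
  -- degree bounds carried along.
  eval : ℕ → Carrier → Seq → Carrier
  eval N x f = sum< N (λ m → f m * x ^ m)

  eval-mul : ∀ N x a {f} → DegreeBelow N f → eval (suc N) x (mul a f) ≈ (1# + a * x) * eval N x f
  eval-mul N x a {f} d = begin
    f 0 * 1# + sum< N (λ m → (f (suc m) + a * f m) * (x * x ^ m))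
      ≈⟨ +-congˡ (sum<-cong N λ m _ → solve 5 (λ u a v x y →
           (u :+ a :* v) :* (x :* y) := u :* (x :* y) :+ a :* x :* (v :* y)) refl (f (suc m)) a (f m) x (x ^ m)) ⟩
    f 0 * 1# + sum< N (λ m → f (suc m) * (x * x ^ m) + a * x * (f m * x ^ m))
      ≈⟨ +-congˡ (sum<-+ N (λ m → f (suc m) * (x * x ^ m)) (λ m → a * x * (f m * x ^ m))) ⟩
    f 0 * 1# + (sum< N (λ m → f (suc m) * (x * x ^ m)) + sum< N (λ m → a * x * (f m * x ^ m)))
      ≈⟨ +-assoc _ _ _ ⟨
    eval (suc N) x f + sum< N (λ m → a * x * (f m * x ^ m))
      ≈⟨ +-cong (trans (sum<-last N (λ m → f m * x ^ m)) (trans (+-congˡ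
          (trans (*-congʳ (d N ℕₚ.≤-refl)) (zeroˡ _))) (+-identityʳ _)))
                (sum<-*ˡ N (a * x) (λ m → f m * x ^ m)) ⟩
    eval N x f + a * x * eval N x f
      ≈⟨ solve 3 (λ a x e → e :+ a :* x :* e := (:1 :+ a :* x) :* e) refl a x (eval N x f) ⟩
    (1# + a * x) * eval N x f ∎

  eval-mul^ : ∀ N x a i {f} → DegreeBelow N f →
              eval (i ℕ.+ N) x (mul^ a i f) ≈ (1# + a * x) ^ i * eval N x f
  eval-mul^ N x a zero    d = sym (*-identityˡ _)
  eval-mul^ N x a (suc i) d =
    trans (eval-mul (i ℕ.+ N) x a (mul^-degree a i d))
    (trans (*-congˡ (eval-mul^ N x a i d)) (sym (*-assoc _ _ _)))

  eval-mul^δ : ∀ x a i → eval (i ℕ.+ 1) x (mul^ a i δ) ≈ (1# + a * x) ^ i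
  eval-mul^δ x a i = trans (eval-mul^ 1 x a i δ-degree)
    (solve 1 (λ y → y :* (:1 :* :1 :+ con (0 , 0)) := y) refl ((1# + a * x) ^ i))

  eval-K : ∀ x i j → eval (i ℕ.+ (j ℕ.+ 1)) x (K i j) ≈ (1# + x) ^ i * (1# - x) ^ j
  eval-K x i j = begin
    eval (i ℕ.+ (j ℕ.+ 1)) x (K i j)         ≈⟨ eval-mul^ (j ℕ.+ 1) x 1# i (mul^-degree (- 1#) j δ-degree) ⟩
    (1# + 1# * x) ^ i * eval (j ℕ.+ 1) x (mul^ (- 1#) j δ) ≈⟨ *-cong (^-congˡ i (+-congˡ (*-identityˡ x)))
                                                       (trans (eval-mul^δ x (- 1#) j) (^-congˡ j (+-congˡ
                                                           (-1*x≈-x x)))) ⟩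
    (1# + x) ^ i * (1# - x) ^ j              ∎

  -- mul^ a i δ is a multiple of the solution of (1 + a x) f′ = a i f.
  mul^δ-recurrence : ∀ a i m → nat (suc m) * mul^ a i δ (suc m) ≈ a * ((nat i - nat m) * mul^ a i δ m)
  mul^δ-recurrence a zero zero = solve 2 (λ a z → (:1 :+ z) :* con (0 , 0) := a :* ((z :- z) :* :1)) refl a (nat 0)
  mul^δ-recurrence a zero (suc m) = solve 3 (λ a k z →
    (:1 :+ k) :* con (0 , 0) := a :* ((z :- k) :* con (0 , 0))) refl a (nat (suc m)) (nat 0)
  mul^δ-recurrence a (suc i) zero = ≈-from₁ (mul^δ-recurrence a i zero) (solve 4 (λ a i f₁ f₀ →
    (:1 :+ con (0 , 0)) :* (f₁ :+ a :* f₀) :- a :* ((:1 :+ i :- con (0 , 0)) :* f₀)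
    := :1 :* ((:1 :+ con (0 , 0)) :* f₁ :- a :* ((i :- con (0 , 0)) :* f₀))) refl a (nat i) (mul^ a i δ 1)
        (mul^ a i δ 0))
  mul^δ-recurrence a (suc i) (suc m) =
    ≈-from₂ (mul^δ-recurrence a i (suc m)) (mul^δ-recurrence a i m) (solve 6 (λ a i m f₂ f₁ f₀ →
    (:1 :+ (:1 :+ m)) :* (f₂ :+ a :* f₁) :- a :* ((:1 :+ i :- (:1 :+ m)) :* (f₁ :+ a :* f₀))
    := :1 :* ((:1 :+ (:1 :+ m)) :* f₂ :- a :* ((i :- (:1 :+ m)) :* f₁))
       :+ a :* ((:1 :+ m) :* f₁ :- a :* ((i :- m) :* f₀)))
    refl a (nat i) (nat m) (mul^ a i δ (2 ℕ.+ m)) (mul^ a i δ (suc m)) (mul^ a i δ m))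

  -- (1 - x²) f′ = (α - β x) f
  Recurrence : Carrier → Carrier → Seq → Set ℓ
  Recurrence α β f = f 1 ≈ α * f 0 ×
    (∀ m → nat (2 ℕ.+ m) * f (2 ℕ.+ m) ≈ α * f (1 ℕ.+ m) - β * f m + nat m * f m)

  -- For a² = 1 one has 1 - x² = (1 + a x) (1 - a x), so the new factor adds a (1 - a x) = a - x to
  -- the logarithmic derivative taken with respect to (1 - x²) d/dx.
  mul-recurrence : ∀ {α β a f} → a * a ≈ 1# → Recurrence α β f → Recurrence (α + a) (1# + β) (mul a f)
  mul-recurrence {α} {β} {a} {f} a²≈1 (r₁ , r) = first , rest
    where
    first = ≈-from₁ r₁ (solve 4 (λ α a f₁ f₀ →
      f₁ :+ a :* f₀ :- (α :+ a) :* f₀ := :1 :* (f₁ :- α :* f₀)) refl α a (f 1) (f 0))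
    rest : ∀ m → _
    rest zero = ≈-from₃ (r 0) r₁ a²≈1 (solve 6 (λ α β a f₂ f₁ f₀ →
      (:1 :+ (:1 :+ con (0 , 0))) :* (f₂ :+ a :* f₁)
        :- ((α :+ a) :* (f₁ :+ a :* f₀) :- (:1 :+ β) :* f₀ :+ con (0 , 0) :* f₀)
      := :1 :* ((:1 :+ (:1 :+ con (0 , 0))) :* f₂ :- (α :* f₁ :- β :* f₀ :+ con (0 , 0) :* f₀))
        :+ a :* (f₁ :- α :* f₀) :+ :- f₀ :* (a :* a :- :1))
      refl α β a (f 2) (f 1) (f 0))
    -- The recurrence for the product is the old one at `suc m` plus `a` times the old one at `m`,
    -- corrected by a² = 1.
    rest (suc m) = ≈-from₃ (r (suc m)) (r m) a²≈1 (solve 8 (λ α β a m f₃ f₂ f₁ f₀ →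
      (:1 :+ (:1 :+ (:1 :+ m))) :* (f₃ :+ a :* f₂)
        :- ((α :+ a) :* (f₂ :+ a :* f₁) :- (:1 :+ β) :* (f₁ :+ a :* f₀) :+ (:1 :+ m) :* (f₁ :+ a :* f₀))
      := :1 :* ((:1 :+ (:1 :+ (:1 :+ m))) :* f₃ :- (α :* f₂ :- β :* f₁ :+ (:1 :+ m) :* f₁))
        :+ a :* ((:1 :+ (:1 :+ m)) :* f₂ :- (α :* f₁ :- β :* f₀ :+ m :* f₀))
        :+ :- f₁ :* (a :* a :- :1))
      refl α β a (nat m) (f (3 ℕ.+ m)) (f (2 ℕ.+ m)) (f (1 ℕ.+ m)) (f m))

  Recurrence-cong : ∀ {α α′ β β′ f} → α ≈ α′ → β ≈ β′ → Recurrence α β f → Recurrence α′ β′ f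
  Recurrence-cong α≈ β≈ (r₁ , r) = trans r₁ (*-congʳ α≈) ,
    λ m → trans (r m) (+-congʳ (+-cong (*-congʳ α≈) (-‿cong (*-congʳ β≈))))

  mul^-recurrence : ∀ {α β a f} → a * a ≈ 1# → ∀ i → Recurrence α β f →
                    Recurrence (α + nat i * a) (nat i + β) (mul^ a i f)
  mul^-recurrence {α} {β} {a} a²≈1 zero    r =
    Recurrence-cong (sym (trans (+-congˡ (zeroˡ a)) (+-identityʳ α))) (sym (+-identityˡ β)) r
  mul^-recurrence {α} {β} {a} a²≈1 (suc i) r = Recurrence-cong
    (solve 3 (λ α a i → α :+ i :* a :+ a := α :+ (:1 :+ i) :* a) refl α a (nat i)) (sym (+-assoc _ _ _))
    (mul-recurrence a²≈1 (mul^-recurrence a²≈1 i r))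

  -- Each factor 1 + x adds 1 to α, each factor 1 - x subtracts 1, and both add 1 to β. Once i + j
  -- vanishes in the ring, β = 0 and the polynomial is an eigenvector of (1 - x²) d/dx.
  K-recurrence : ∀ i j → Recurrence (nat i - nat j) (nat i + nat j) (K i j)
  K-recurrence i j = Recurrence-cong
    (solve 2 (λ i j → con (0 , 0) :+ j :* :- :1 :+ i :* :1 := i :- j) refl (nat i) (nat j))
    (+-congˡ (+-identityʳ (nat j)))
    (mul^-recurrence (*-identityˡ 1#) i (mul^-recurrence (solve 0 (:- :1 :* :- :1 := :1) refl) j δ-recurrence))
    where
    δ-recurrence : Recurrence 0# 0# δ
    δ-recurrence = sym (zeroˡ 1#) , λ where
      zero    → solve 0 ((:1 :+ (:1 :+ con (0 , 0))) :* con (0 , 0)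
          := con (0 , 0) :* con (0 , 0) :- con (0 , 0) :* :1 :+ con (0 , 0) :* :1) refl
      (suc m) → solve 1 (λ k → (:1 :+ (:1 :+ k)) :* con (0 , 0)
          := con (0 , 0) :* con (0 , 0) :- con (0 , 0) :* con (0 , 0) :+ k :* con (0 , 0)) refl (nat (suc m))

  -- Coefficient form of (1 + x) - (1 - x) = 2 x; it drives the telescoping in `Z-suc`.
  K-shift : ∀ i j m → K (suc i) j (suc m) - K i (suc j) (suc m) ≈ (1# + 1#) * K i j m
  K-shift i j m = trans (+-congˡ (-‿cong (mul^-mul 1# i (- 1#) (mul^ (- 1#) j δ) (suc m))))
    (solve 2 (λ u v → u :+ :1 :* v :- (u :+ :- :1 :* v) := (:1 :+ :1) :* v) refl (K i j (suc m)) (K i j m))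

  mul^δ-top : ∀ i → mul^ 1# i δ i ≈ 1#
  mul^δ-top zero    = refl
  mul^δ-top (suc i) = trans (+-cong (mul^-degree 1# i δ-degree (suc i) (ℕₚ.≤-reflexive (ℕₚ.+-comm i 1))) (*-congˡ
      (mul^δ-top i)))
    (solve 0 (con (0 , 0) :+ :1 :* :1 := :1) refl)

-- Arithmetic in odd characteristic p.

-- ι i is the inverse of i + 1, and the characteristic is the odd number 2 n + 1.
module Characteristic {c ℓ} (R : CommutativeRing c ℓ) (n : ℕ) (2≤n : 2 ≤ n)
  (p≈0 : CommutativeRing._≈_ R (Expansion.nat R (suc (n ℕ.* 2))) (CommutativeRing.0# R))
  (ι : ℕ → CommutativeRing.Carrier R)
  (ι-inverse : ∀ i → i < n ℕ.* 2 →
     CommutativeRing._≈_ R (CommutativeRing._*_ R (Expansion.nat R (suc i)) (ι i)) (CommutativeRing.1# R))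
  where
  open CommutativeRing R hiding (zero)
  open import Algebra.Properties.Semiring.Mult semiring using (×-homo-+)
  open import Algebra.Properties.Semiring.Exp semiring
  open import Algebra.Properties.CommutativeSemiring.Exp commutativeSemiring using (^-distrib-*)
  open import Algebra.Properties.Ring ring
  open import Relation.Binary.Reasoning.Setoid setoid
  open IntegerCoefficientSolver R
  open InitialSums R
  open Expansion R

  q p : ℕ
  q = n ℕ.* 2
  p = suc q

  4≤q : 4 ≤ q
  4≤q = ℕₚ.*-monoˡ-≤ 2 2≤n

  *2-< : ∀ {k} → k < n → suc (k ℕ.* 2) < q
  *2-< k<n = ℕₚ.*-monoˡ-≤ 2 k<n

  nat-+ : ∀ i j → nat (i ℕ.+ j) ≈ nat i + nat j
  nat-+ = ×-homo-+ 1#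

  nat-*2 : ∀ k → nat (k ℕ.* 2) ≈ nat k + nat k
  nat-*2 zero    = sym (+-identityˡ _)
  nat-*2 (suc k) = trans (+-congˡ (+-congˡ (nat-*2 k)))
    (solve 1 (λ k → :1 :+ (:1 :+ (k :+ k)) := :1 :+ k :+ (:1 :+ k)) refl (nat k))

  -- Multiplication by the inverse `ι i` does the cancelling, which is sound in the presence of zero
  -- divisors.
  cancel-nat : ∀ i → i < q → ∀ {x y} → nat (suc i) * x ≈ nat (suc i) * y → x ≈ y
  cancel-nat i i<q {x} {y} eq = ≈-from₂ eq (ι-inverse i i<q) (solve 4 (λ k u x y →
    x :- y := u :* (k :* x :- k :* y) :+ :- (x :- y) :* (k :* u :- :1)) refl (nat (suc i)) (ι i) x y)

  cancel-2 : ∀ {x y} → (1# + 1#) * x ≈ (1# + 1#) * y → x ≈ y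
  cancel-2 eq = cancel-nat 1 (ℕₚ.≤-trans (s≤s (s≤s z≤n)) 4≤q)
    (trans (*-congʳ 2≈) (trans eq (sym (*-congʳ 2≈))))
    where
    2≈ : nat 2 ≈ 1# + 1#
    2≈ = +-congˡ (+-identityʳ 1#)

  -- The hypothesis says (i + 1) + (j + 1) = p, so this is 1 / (p - k) = - 1 / k.
  ι-neg : ∀ i j → suc (i ℕ.+ j) ≡ q → ι j ≈ - ι i
  ι-neg i j eq = cancel-nat j j<q (≈-from₃ (ι-inverse j j<q) (ι-inverse i i<q) sum≈0
    (solve 4 (λ a b u v → b :* v :- b :* :- u :=
      :1 :* (b :* v :- :1) :+ :- :1 :* (a :* u :- :1) :+ u :* (a :+ b :- con (0 , 0)))
      refl (nat (suc i)) (nat (suc j)) (ι i) (ι j)))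
    where
    i<q : i < q
    i<q = ℕₚ.≤-trans (s≤s (ℕₚ.m≤m+n i j)) (ℕₚ.≤-reflexive eq)
    j<q : j < q
    j<q = ℕₚ.≤-trans (s≤s (ℕₚ.m≤n+m j i)) (ℕₚ.≤-reflexive eq)
    sum≈0 : nat (suc i) + nat (suc j) ≈ 0#
    sum≈0 = trans (sym (nat-+ (suc i) (suc j)))
      (trans (reflexive (≡.cong nat (≡.cong suc (≡.trans (ℕₚ.+-suc i j) eq)))) p≈0)

  ι-double : ∀ k → k < n → ι k ≈ (1# + 1#) * ι (suc (k ℕ.* 2))
  ι-double k k<n = cancel-nat k (ℕₚ.<-≤-trans k<n (ℕₚ.m≤m*n n 2)) (≈-from₃
    (ι-inverse k (ℕₚ.<-≤-trans k<n (ℕₚ.m≤m*n n 2))) (ι-inverse (suc (k ℕ.* 2)) (*2-< k<n)) (nat-*2 k)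
    (solve 4 (λ k l u v → (:1 :+ k) :* u :- (:1 :+ k) :* ((:1 :+ :1) :* v) :=
      :1 :* ((:1 :+ k) :* u :- :1) :+ :- :1 :* ((:1 :+ (:1 :+ l)) :* v :- :1) :+ v :* (l :- (k :+ k)))
      refl (nat k) (nat (k ℕ.* 2)) (ι k) (ι (suc (k ℕ.* 2)))))

  q≡n+n : q ≡ n ℕ.+ n
  q≡n+n = ≡.trans (ℕₚ.*-comm n 2) (≡.cong (n ℕ.+_) (ℕₚ.+-identityʳ n))

  -- In characteristic p, 2 (n + k + 1) = p + (2 k + 1) = 2 k + 1.
  ι-halve : ∀ k → k < n → ι (n ℕ.+ k) ≈ (1# + 1#) * ι (k ℕ.* 2)
  ι-halve k k<n = cancel-nat (n ℕ.+ k) n+k<q (≈-from₃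
    (ι-inverse (n ℕ.+ k) n+k<q) (ι-inverse (k ℕ.* 2) (ℕₚ.<-trans (ℕₚ.n<1+n _) (*2-< k<n))) double
    (solve 4 (λ a l u v → a :* u :- a :* ((:1 :+ :1) :* v) :=
      :1 :* (a :* u :- :1) :+ :- :1 :* ((:1 :+ l) :* v :- :1) :+ :- v :* (a :+ a :- (:1 :+ l)))
      refl (nat (suc (n ℕ.+ k))) (nat (k ℕ.* 2)) (ι (n ℕ.+ k)) (ι (k ℕ.* 2))))
    where
    n+k<q : n ℕ.+ k < q
    n+k<q = ≡.subst (n ℕ.+ k <_) (≡.sym q≡n+n) (ℕₚ.+-monoʳ-< n k<n)
    double : nat (suc (n ℕ.+ k)) + nat (suc (n ℕ.+ k)) ≈ 1# + nat (k ℕ.* 2)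
    double = begin
      nat (suc (n ℕ.+ k)) + nat (suc (n ℕ.+ k))   ≈⟨ +-cong (+-congˡ (nat-+ n k)) (+-congˡ (nat-+ n k)) ⟩
      1# + (nat n + nat k) + (1# + (nat n + nat k)) ≈⟨ solve 2 (λ n k → :1 :+ (n :+ k) :+ (:1 :+ (n :+ k))
          := :1 :+ (n :+ n) :+ (:1 :+ (k :+ k))) refl (nat n) (nat k) ⟩
      1# + (nat n + nat n) + (1# + (nat k + nat k)) ≈⟨ +-cong (+-congˡ (nat-*2 n)) (+-congˡ (nat-*2 k)) ⟨
      nat p + (1# + nat (k ℕ.* 2))                  ≈⟨ trans (+-congʳ p≈0) (+-identityˡ _) ⟩
      1# + nat (k ℕ.* 2)                            ∎

  -- The binomial coefficients strictly between the ends. The recurrence starts with the factor p -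
  -- 0 = 0, and every later step only divides by some m + 1 < p, so zero propagates.
  mul^δ-middle : ∀ a m → m < q → mul^ a p δ (suc m) ≈ 0#
  mul^δ-middle a m m<q = cancel-nat m m<q
    (trans (mul^δ-recurrence a p m) (trans (*-congˡ (vanishes m m<q)) (trans (zeroʳ a) (sym (zeroʳ _)))))
    where
    vanishes : ∀ m → m < q → (nat p - nat m) * mul^ a p δ m ≈ 0#
    vanishes zero    _   = trans (*-congʳ (trans (+-congʳ p≈0) (-‿inverseʳ 0#))) (zeroˡ _)
    vanishes (suc m) m<q = trans (*-congˡ (mul^δ-middle a m (ℕₚ.<-trans (ℕₚ.n<1+n m) m<q))) (zeroʳ _)

  frobenius : ∀ y → (1# + y) ^ p ≈ 1# + y ^ p
  frobenius y = begin
    (1# + y) ^ p                    ≈⟨ ^-congˡ p (+-congˡ (*-identityˡ y)) ⟨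
    (1# + 1# * y) ^ p               ≈⟨ eval-mul^δ y 1# p ⟨
    term 0 + sum< (q ℕ.+ 1) (λ m → term (suc m))
      ≈⟨ +-cong (trans (*-identityʳ _) (mul^-0 1# p δ))
                (trans (reflexive (≡.cong (λ k → sum< k (λ m → term (suc m))) (ℕₚ.+-comm q 1)))
                    (sum<-last q (λ m → term (suc m)))) ⟩
    1# + (sum< q (λ m → term (suc m)) + term p)
      ≈⟨ +-congˡ (+-cong (sum<-zero q λ m m<q → trans (*-congʳ (mul^δ-middle 1# m m<q)) (zeroˡ _))
                          (trans (*-congʳ (mul^δ-top p)) (*-identityˡ _))) ⟩
    1# + (0# + y ^ p)               ≈⟨ +-congˡ (+-identityˡ _) ⟩
    1# + y ^ p                      ∎
    where
    term : ℕ → Carrier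
    term m = mul^ 1# p δ m * y ^ m

  fermat : ∀ i → nat i ^ p ≈ nat i
  fermat zero    = zeroˡ _
  fermat (suc i) = trans (frobenius (nat i)) (+-congˡ (fermat i))

  -- Fermat gives k³ kᵉ = kᵖ = k; multiply by the cube of the inverse of k.
  power-inverse : ∀ e → 3 ℕ.+ e ≡ p → ∀ i → i < q → nat (suc i) ^ e ≈ ι i * ι i
  power-inverse e 3+e≡p i i<q = ≈-from₂
    (trans (^-congʳ (nat (suc i)) 3+e≡p) (fermat (suc i))) (ι-inverse i i<q)
    (solve 3 (λ x u z → z :- u :* u := u :* u :* u :* (x :* (x :* (x :* z)) :- x)
      :+ (u :* u :- z :* (:1 :+ x :* u :+ x :* u :* (x :* u))) :* (x :* u :- :1))
      refl (nat (suc i)) (ι i) (nat (suc i) ^ e))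

  neg^-*2 : ∀ y k → (- y) ^ (k ℕ.* 2) ≈ y ^ (k ℕ.* 2)
  neg^-*2 y zero    = refl
  neg^-*2 y (suc k) = trans (*-congˡ (*-congˡ (neg^-*2 y k)))
    (solve 2 (λ y z → :- y :* (:- y :* z) := y :* (y :* z)) refl y (y ^ (k ℕ.* 2)))

  neg^-odd : ∀ y k → (- y) ^ suc (k ℕ.* 2) ≈ - y ^ suc (k ℕ.* 2)
  neg^-odd y k = trans (*-congˡ (neg^-*2 y k)) (sym (-‿distribˡ-* _ _))

  square^ : ∀ y k → (y * y) ^ k ≈ y ^ (k ℕ.* 2)
  square^ y zero    = refl
  square^ y (suc k) = trans (*-congˡ (square^ y k)) (*-assoc _ _ _)

  -- The finite dilogarithm and its duplication relation.

  -- The finite dilogarithm Σ yᵏ / k², with k = i + 1.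
  Li₂ : Carrier → Carrier
  Li₂ y = sum< q (λ i → ι i * ι i * y ^ suc i)

  Li₂-cong : ∀ {x y} → x ≈ y → Li₂ x ≈ Li₂ y
  Li₂-cong x≈y = sum<-cong q λ i _ → *-congˡ (^-congˡ (suc i) x≈y)

  module _ (y : Carrier) where
    odd even : Carrier
    odd  = sum< n (λ k → ι (k ℕ.* 2) * ι (k ℕ.* 2) * y ^ suc (k ℕ.* 2))
    even = sum< n (λ k → ι (suc (k ℕ.* 2)) * ι (suc (k ℕ.* 2)) * y ^ (suc k ℕ.* 2))

    Li₂-split : Li₂ y ≈ odd + even
    Li₂-split = trans (sum<-blocks n 2 (λ i → ι i * ι i * y ^ suc i))
      (trans (sum<-cong n λ k _ → +-congˡ (+-identityʳ _)) (sum<-+ n _ _))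

  Li₂-neg : ∀ y → Li₂ (- y) ≈ - odd y + even y
  Li₂-neg y = trans (Li₂-split (- y)) (+-cong
    (trans (sum<-cong n λ k _ → trans (*-congˡ (neg^-odd y k)) (x*-y≈-1*[x*y] _ _))
      (trans (sum<-*ˡ n (- 1#) (λ k → ι (k ℕ.* 2) * ι (k ℕ.* 2) * y ^ suc (k ℕ.* 2))) (-1*x≈-x _)))
    (sum<-cong n λ k _ → *-congˡ (neg^-*2 y (suc k))))
    where
    x*-y≈-1*[x*y] : ∀ x y → x * - y ≈ - 1# * (x * y)
    x*-y≈-1*[x*y] = solve 2 (λ x y → x :* :- y := :- :1 :* (x :* y)) refl

  -- Split Σ y²ᵏ / k² after k = n. For k ≤ n the term is 4 y²ᵏ / (2 k)², which yields the even terms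
  -- of L(y) four times. For k = n + 1 + j one has 2 k = p + (2 j + 1), which yields the odd terms,
  -- times 4 yᵖ. Even and odd part are half of L(y) ± L(- y).
  Li₂-square : ∀ y → Li₂ (y * y) ≈ (1# + 1#) * (1# + y ^ p) * Li₂ y + (1# + 1#) * (1# - y ^ p) * Li₂ (- y)
  Li₂-square y = begin
    Li₂ (y * y)
      ≈⟨ reflexive (≡.cong (λ k → sum< k f) q≡n+n) ⟩
    sum< (n ℕ.+ n) f
      ≈⟨ sum<-append n n f ⟩
    sum< n f + sum< n (λ k → f (n ℕ.+ k))
      ≈⟨ +-cong (trans (sum<-cong n lower) (sum<-*ˡ n 4# (λ k → ι (suc (k ℕ.* 2)) * ι (suc (k ℕ.* 2)) * y ^
          (suc k ℕ.* 2))))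
                (trans (sum<-cong n upper) (sum<-*ˡ n (4# * y ^ p) (λ k → ι (k ℕ.* 2) * ι (k ℕ.* 2) * y ^ suc
                    (k ℕ.* 2)))) ⟩
    4# * even y + 4# * y ^ p * odd y
      ≈⟨ solve 3 (λ e o z → 4: :* e :+ 4: :* z :* o :=
           2: :* (:1 :+ z) :* (o :+ e) :+ 2: :* (:1 :- z) :* (:- o :+ e)) refl (even y) (odd y) (y ^ p) ⟩
    (1# + 1#) * (1# + y ^ p) * (odd y + even y) + (1# + 1#) * (1# - y ^ p) * (- odd y + even y)
      ≈⟨ +-cong (*-congˡ (Li₂-split y)) (*-congˡ (Li₂-neg y)) ⟨
    (1# + 1#) * (1# + y ^ p) * Li₂ y + (1# + 1#) * (1# - y ^ p) * Li₂ (- y) ∎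
    where
    f : ℕ → Carrier
    f i = ι i * ι i * (y * y) ^ suc i
    4# : Carrier
    4# = (1# + 1#) * (1# + 1#)
    2: 4: : ∀ {k} → Polynomial k
    2: = :1 :+ :1
    4: = 2: :* 2:
    lower : ∀ k → k < n → f k ≈ 4# * (ι (suc (k ℕ.* 2)) * ι (suc (k ℕ.* 2)) * y ^ (suc k ℕ.* 2))
    lower k k<n = trans (*-cong (*-cong (ι-double k k<n) (ι-double k k<n)) (square^ y (suc k)))
      (solve 2 (λ u z → 2: :* u :* (2: :* u) :* z := 4: :* (u :* u :* z))
          refl (ι (suc (k ℕ.* 2))) (y ^ (suc k ℕ.* 2)))
    upper : ∀ k → k < n → f (n ℕ.+ k) ≈ 4# * y ^ p * (ι (k ℕ.* 2) * ι (k ℕ.* 2) * y ^ suc (k ℕ.* 2))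
    upper k k<n = trans (*-cong (*-cong (ι-halve k k<n) (ι-halve k k<n)) power)
      (solve 3 (λ u x z → 2: :* u :* (2: :* u) :* (x :* z) := 4: :* x :* (u :* u :* z))
          refl (ι (k ℕ.* 2)) (y ^ p) (y ^ suc (k ℕ.* 2)))
      where
      power : (y * y) ^ suc (n ℕ.+ k) ≈ y ^ p * y ^ suc (k ℕ.* 2)
      power = trans (square^ y (suc (n ℕ.+ k)))
        (trans (^-congʳ y (≡.trans (≡.cong (2 ℕ.+_) (ℕₚ.*-distribʳ-+ 2 n k)) (≡.cong suc (≡.sym (ℕₚ.+-suc q
            (k ℕ.* 2))))))
               (^-homo-* y p (suc (k ℕ.* 2))))

  1^≈1 : ∀ k → 1# ^ k ≈ 1#
  1^≈1 zero    = refl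
  1^≈1 (suc k) = trans (*-identityˡ _) (1^≈1 k)

  -- Duplication at y = 1 gives L(1) = 4 L(1), and 3 is invertible because p ≥ 5.
  sum-ι² : sum< q (λ i → ι i * ι i) ≈ 0#
  sum-ι² = trans (sum<-cong q λ i _ → sym (trans (*-congˡ (1^≈1 (suc i))) (*-identityʳ _)))
    (cancel-nat 2 (ℕₚ.<-≤-trans (ℕₚ.n<1+n 2) (ℕₚ.≤-trans (ℕₚ.n≤1+n 3) 4≤q))
      (≈-from₃ (Li₂-square 1#) (Li₂-cong (*-identityˡ 1#)) (1^≈1 p) (solve 4 (λ l m l₂ z →
        (:1 :+ (:1 :+ (:1 :+ con (0 , 0)))) :* l :- (:1 :+ (:1 :+ (:1 :+ con (0 , 0)))) :* con (0 , 0) :=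
        :- :1 :* (l₂ :- ((:1 :+ :1) :* (:1 :+ z) :* l :+ (:1 :+ :1) :* (:1 :- z) :* m))
        :+ :1 :* (l₂ :- l) :+ :- ((:1 :+ :1) :* (l :- m)) :* (z :- :1))
        refl (Li₂ 1#) (Li₂ (- 1#)) (Li₂ (1# * 1#)) (1# ^ p))))

  -- The polynomials Σ gₖ, Σ gₖ / k and Σ gₖ / k².

  h : ℕ → Seq
  h i = K (suc i) (q ∸ i)

  -- With k = i + 1 the exponents are k and p - k: their sum is 0 in the ring, and their difference
  -- is 2 k.
  h-recurrence : ∀ i → i < q → Recurrence ((1# + 1#) * nat (suc i)) 0# (h i)
  h-recurrence i i<q = Recurrence-cong
    (≈-from₁ sum≈0 (solve 2 (λ a b → a :- b :- (:1 :+ :1) :* a := :- :1 :* (a :+ b :- con (0 , 0)))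
      refl (nat (suc i)) (nat (q ∸ i))))
    sum≈0 (K-recurrence (suc i) (q ∸ i))
    where
    sum≈0 : nat (suc i) + nat (q ∸ i) ≈ 0#
    sum≈0 = trans (sym (nat-+ (suc i) (q ∸ i)))
      (trans (reflexive (≡.cong nat (≡.cong suc (ℕₚ.m+[n∸m]≡n (ℕₚ.<⇒≤ i<q))))) p≈0)

  -- The coefficients of Σ wᵢ (1 + x)ⁱ⁺¹ (1 - x)^(q - i); multiplying the weight
  -- by i + 1 amounts to applying ½ (1 - x²) d/dx.
  moment : (ℕ → Carrier) → Seq
  moment w m = sum< q (λ i → w i * h i m)

  module _ {w v : ℕ → Carrier} (w≈v : ∀ i → i < q → nat (suc i) * w i ≈ v i) where

    moment-1 : moment w 1 ≈ (1# + 1#) * moment v 0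
    moment-1 = trans (sum<-cong q λ i i<q → ≈-from₂ (proj₁ (h-recurrence i i<q)) (w≈v i i<q)
        (solve 5 (λ w v k h₁ h₀ → w :* h₁ :- (:1 :+ :1) :* (v :* h₀) :=
          w :* (h₁ :- (:1 :+ :1) :* k :* h₀) :+ (:1 :+ :1) :* h₀ :* (k :* w :- v))
          refl (w i) (v i) (nat (suc i)) (h i 1) (h i 0)))
      (sum<-*ˡ q (1# + 1#) (λ i → v i * h i 0))

    moment-recurrence : ∀ m → nat (2 ℕ.+ m) * moment w (2 ℕ.+ m) ≈
                        (1# + 1#) * moment v (1 ℕ.+ m) + nat m * moment w m
    moment-recurrence m = begin
      nat (2 ℕ.+ m) * moment w (2 ℕ.+ m)
        ≈⟨ sum<-*ˡ q (nat (2 ℕ.+ m)) (λ i → w i * h i (2 ℕ.+ m)) ⟨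
      sum< q (λ i → nat (2 ℕ.+ m) * (w i * h i (2 ℕ.+ m)))
        ≈⟨ sum<-cong q (λ i i<q → ≈-from₂ (proj₂ (h-recurrence i i<q) m) (w≈v i i<q)
             (solve 8 (λ w v k n₂ n h₂ h₁ h₀ → n₂ :* (w :* h₂) :- ((:1 :+ :1) :* (v :* h₁) :+ n :* (w :* h₀)) :=
               w :* (n₂ :* h₂ :- ((:1 :+ :1) :* k :* h₁ :- con (0 , 0) :* h₀ :+ n :* h₀))
               :+ (:1 :+ :1) :* h₁ :* (k :* w :- v))
               refl (w i) (v i) (nat (suc i)) (nat (2 ℕ.+ m)) (nat m) (h i (2 ℕ.+ m)) (h i (1 ℕ.+ m)) (h i m))) ⟩
      sum< q (λ i → (1# + 1#) * (v i * h i (1 ℕ.+ m)) + nat m * (w i * h i m))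
        ≈⟨ sum<-+ q _ _ ⟩
      sum< q (λ i → (1# + 1#) * (v i * h i (1 ℕ.+ m))) + sum< q (λ i → nat m * (w i * h i m))
        ≈⟨ +-cong (sum<-*ˡ q (1# + 1#) _) (sum<-*ˡ q (nat m) _) ⟩
      (1# + 1#) * moment v (1 ℕ.+ m) + nat m * moment w m ∎

  -- The weights 1, 1 / k and 1 / k²: half of (1 - x²) d/dx takes `W` to `V` and `V` to `Z`.
  Z V W : Seq
  Z = moment (λ _ → 1#)
  V = moment ι
  W = moment (λ i → ι i * ι i)

  ι²-inverse : ∀ i → i < q → nat (suc i) * (ι i * ι i) ≈ ι i
  ι²-inverse i i<q = trans (sym (*-assoc _ _ _)) (trans (*-congʳ (ι-inverse i i<q)) (*-identityˡ _))

  moment-0 : ∀ w → moment w 0 ≈ sum< q w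
  moment-0 w = sum<-cong q λ i _ → trans (*-congˡ (K-0 (suc i) (q ∸ i))) (*-identityʳ _)

  -- There are p - 1 summands, each with constant coefficient 1.
  Z-0 : 1# + Z 0 ≈ 0#
  Z-0 = trans (+-congˡ (trans (moment-0 _) (sum<-1 q))) p≈0
    where
    sum<-1 : ∀ k → sum< k (λ _ → 1#) ≈ nat k
    sum<-1 zero    = refl
    sum<-1 (suc k) = +-congˡ (sum<-1 k)

  -- Multiplied by 2 x, the sum telescopes to (1 + x)ᵖ (1 - x) - (1 - x)ᵖ (1 + x), whose
  -- coefficients from x² to xᵖ⁻¹ involve only vanishing binomial coefficients.
  Z-suc : ∀ m → suc m < q → Z (suc m) ≈ 0#
  Z-suc m m<q = cancel-2 (begin
    (1# + 1#) * Z (suc m)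
      ≈⟨ sum<-*ˡ q (1# + 1#) (λ i → 1# * h i (suc m)) ⟨
    sum< q (λ i → (1# + 1#) * (1# * h i (suc m)))
      ≈⟨ sum<-cong q difference ⟩
    sum< q (λ i → F (suc i) - F i)
      ≈⟨ sum<-telescope q F ⟩
    F q - F 0
      ≈⟨ +-cong Fq (-‿cong F0) ⟩
    0# - 0#
      ≈⟨ solve 0 (con (0 , 0) :- con (0 , 0) := (:1 :+ :1) :* con (0 , 0)) refl ⟩
    (1# + 1#) * 0# ∎)
    where
    F : ℕ → Carrier
    F i = K (suc i) (suc q ∸ i) (2 ℕ.+ m)
    difference : ∀ i → i < q → (1# + 1#) * (1# * h i (suc m)) ≈ F (suc i) - F i
    difference i i<q = trans (*-congˡ (*-identityˡ _)) (trans (sym (K-shift (suc i) (q ∸ i) (suc m)))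
      (+-congˡ (-‿cong (reflexive (≡.cong (λ j → K (suc i) j (2 ℕ.+ m)) (≡.sym (ℕₚ.+-∸-assoc 1 (ℕₚ.<⇒≤ i<q))))))))
    middle : ∀ a b → mul b (mul^ a p δ) (2 ℕ.+ m) ≈ 0#
    middle a b = trans (+-cong (mul^δ-middle a (suc m) m<q)
      (trans (*-congˡ (mul^δ-middle a m (ℕₚ.<-trans (ℕₚ.n<1+n m) m<q))) (zeroʳ b))) (+-identityˡ _)
    Fq : F q ≈ 0#
    Fq = trans (reflexive (≡.cong (λ j → K p j (2 ℕ.+ m)) (ℕₚ.m+n∸n≡m 1 q)))
      (trans (mul^-mul 1# p (- 1#) δ (2 ℕ.+ m)) (middle 1# (- 1#)))
    F0 : F 0 ≈ 0#
    F0 = middle (- 1#) 1#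

  -- Below degree p - 1, (1 - x²) V′ = 2 Σ gₖ = - 2, so the odd coefficients are those of - 2 artanh
  -- x.
  V-odd : ∀ k → k < n → V (suc (k ℕ.* 2)) ≈ - ((1# + 1#) * ι (k ℕ.* 2))
  V-odd zero    _     = ≈-from₃ (moment-1 ι-inverse) Z-0 (ι-inverse 0 (ℕₚ.≤-trans (s≤s z≤n) 4≤q))
    (solve 3 (λ v z u → v :- :- ((:1 :+ :1) :* u) :=
      :1 :* (v :- (:1 :+ :1) :* z) :+ (:1 :+ :1) :* (:1 :+ z :- con (0 , 0)) :+ (:1 :+ :1) :* ((:1 :+ con
          (0 , 0)) :* u :- :1))
      refl (V 1) (Z 0) (ι 0))
  V-odd (suc k) 1+k<n = cancel-nat (2 ℕ.+ k ℕ.* 2) 2+2k<q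
    (≈-from₃ recurrence (ι-inverse (2 ℕ.+ k ℕ.* 2) 2+2k<q) (trans (*-congˡ (V-odd k k<n))
      (trans (x*-[2*y] _ _) (-‿cong (*-congˡ (ι-inverse (k ℕ.* 2) (ℕₚ.<-trans (ℕₚ.n<1+n _) (*2-< k<n)))))))
      (solve 5 (λ n₃ n₁ v₃ v₁ u → n₃ :* v₃ :- n₃ :* :- ((:1 :+ :1) :* u) :=
        :1 :* (n₃ :* v₃ :- n₁ :* v₁) :+ (:1 :+ :1) :* (n₃ :* u :- :1)
        :+ :1 :* (n₁ :* v₁ :- :- ((:1 :+ :1) :* :1)))
        refl (nat (3 ℕ.+ k ℕ.* 2)) (nat (suc (k ℕ.* 2))) (V (3 ℕ.+ k ℕ.* 2)) (V (suc (k ℕ.* 2))) (ι (2 ℕ.+ k ℕ.* 2))))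
    where
    k<n : k < n
    k<n = ℕₚ.<-trans (ℕₚ.n<1+n k) 1+k<n
    2+2k<q : 2 ℕ.+ k ℕ.* 2 < q
    2+2k<q = ℕₚ.<-trans (ℕₚ.n<1+n _) (*2-< 1+k<n)
    x*-[2*y] : ∀ x y → x * - ((1# + 1#) * y) ≈ - ((1# + 1#) * (x * y))
    x*-[2*y] = solve 2 (λ x y → x :* :- ((:1 :+ :1) :* y) := :- ((:1 :+ :1) :* (x :* y))) refl
    recurrence : nat (3 ℕ.+ k ℕ.* 2) * V (3 ℕ.+ k ℕ.* 2) ≈ nat (suc (k ℕ.* 2)) * V (suc (k ℕ.* 2))
    recurrence = trans (moment-recurrence ι-inverse (suc (k ℕ.* 2)))
      (trans (+-congʳ (trans (*-congˡ (Z-suc (suc (k ℕ.* 2)) 2+2k<q)) (zeroʳ _))) (+-identityˡ _))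

  O : ℕ → Carrier
  O k = sum< k (λ j → ι (j ℕ.* 2))

  -- The recurrence makes m times the m-th coefficient grow by 2 V, so the odd reciprocals
  -- accumulate into `O k`. The product form covers k = 0, where the recurrence determines nothing;
  -- `W 0` is supplied by `sum-ι²`.
  W-even : ∀ k → k ≤ n → nat k * W (k ℕ.* 2) ≈ - ((1# + 1#) * O k)
  W-even zero    _   = solve 1 (λ w → con (0 , 0) :* w := :- ((:1 :+ :1) :* con (0 , 0))) refl (W 0)
  W-even (suc k) k<n = trans
    (cancel-2 (≈-from₂ recurrence (nat-*2 k) (solve 5 (λ k l w o u →
      (:1 :+ :1) :* ((:1 :+ k) :* w) :- (:1 :+ :1) :* :- ((:1 :+ :1) :* (o :+ u)) :=
      :1 :* ((:1 :+ (:1 :+ l)) :* w :- ((:1 :+ :1) :* :- ((:1 :+ :1) :* u) :+ :- ((:1 :+ :1) :* ((:1 :+ :1) :* o))))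
      :+ :- w :* (l :- (k :+ k)))
      refl (nat k) (nat (k ℕ.* 2)) (W (suc k ℕ.* 2)) (O k) (ι (k ℕ.* 2)))))
    (-‿cong (*-congˡ (sym (sum<-last k (λ j → ι (j ℕ.* 2))))))
    where
    previous : nat (k ℕ.* 2) * W (k ℕ.* 2) ≈ - ((1# + 1#) * ((1# + 1#) * O k))
    previous = ≈-from₂ (nat-*2 k) (W-even k (ℕₚ.<⇒≤ k<n)) (solve 4 (λ l k w o →
      l :* w :- :- ((:1 :+ :1) :* ((:1 :+ :1) :* o)) :=
      w :* (l :- (k :+ k)) :+ (:1 :+ :1) :* (k :* w :- :- ((:1 :+ :1) :* o)))
      refl (nat (k ℕ.* 2)) (nat k) (W (k ℕ.* 2)) (O k))
    recurrence : nat (suc k ℕ.* 2) * W (suc k ℕ.* 2) ≈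
                 (1# + 1#) * - ((1# + 1#) * ι (k ℕ.* 2)) + - ((1# + 1#) * ((1# + 1#) * O k))
    recurrence = trans (moment-recurrence ι²-inverse (k ℕ.* 2)) (+-cong (*-congˡ (V-odd k k<n)) previous)

  sign-odd : ∀ k → sign (suc (k ℕ.* 2)) ≈ - 1#
  sign-odd zero    = refl
  sign-odd (suc k) = trans (-‿involutive _) (sign-odd k)

  -- Replacing k by p - k keeps 1 / k² and exchanges the exponents, so the polynomial is invariant
  -- under x ↦ - x.
  W-odd : ∀ k → W (suc (k ℕ.* 2)) ≈ 0#
  W-odd k = cancel-2 (≈-from₂ parity (sign-odd k) (solve 2 (λ w s →
    (:1 :+ :1) :* w :- (:1 :+ :1) :* con (0 , 0) := :1 :* (w :- s :* w) :+ w :* (s :- :- :1))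
    refl (W m) (sign m)))
    where
    m : ℕ
    m = suc (k ℕ.* 2)
    flipped : ∀ i → i < q → ι (q ∸ suc i) * ι (q ∸ suc i) * h (q ∸ suc i) m ≈ sign m * (ι i * ι i * h i m)
    flipped i i<q = begin
      ι j * ι j * K (suc j) (q ∸ j) m          ≈⟨ *-cong (*-cong ι-j ι-j)
          (reflexive (≡.cong₂ (λ a b → K a b m) 1+j≡q∸i q∸j≡1+i)) ⟩
      - ι i * - ι i * K (q ∸ i) (suc i) m      ≈⟨ *-congˡ (K-flip (q ∸ i) (suc i) m) ⟩
      - ι i * - ι i * (sign m * h i m)         ≈⟨ solve 3 (λ u s h → :- u :* :- u :* (s :* h) := s :* (u :* u :* h))
          refl (ι i) (sign m) (h i m) ⟩
      sign m * (ι i * ι i * h i m)             ∎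
      where
      j : ℕ
      j = q ∸ suc i
      1+i+j≡q : suc i ℕ.+ j ≡ q
      1+i+j≡q = ℕₚ.m+[n∸m]≡n i<q
      1+j≡q∸i : suc j ≡ q ∸ i
      1+j≡q∸i = ≡.sym (ℕₚ.+-∸-assoc 1 i<q)
      q∸j≡1+i : q ∸ j ≡ suc i
      q∸j≡1+i = ≡.trans (≡.cong (_∸ j) (≡.sym 1+i+j≡q)) (ℕₚ.m+n∸n≡m (suc i) j)
      ι-j : ι j ≈ - ι i
      ι-j = ι-neg i j 1+i+j≡q
    parity : W m ≈ sign m * W m
    parity = trans (sum<-reverse q (λ i → ι i * ι i * h i m)) (trans (sum<-cong q flipped)
      (sum<-*ˡ q (sign m) (λ i → ι i * ι i * h i m)))

  W-positive : ∀ k → k < n → W (suc k ℕ.* 2) ≈ - ((1# + 1#) * (ι k * O (suc k)))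
  W-positive k k<n = cancel-nat k k<q (≈-from₂ (W-even (suc k) k<n) (ι-inverse k k<q) (solve 4 (λ a w u o →
    a :* w :- a :* :- ((:1 :+ :1) :* (u :* o)) :=
    :1 :* (a :* w :- :- ((:1 :+ :1) :* o)) :+ (:1 :+ :1) :* o :* (a :* u :- :1))
    refl (nat (suc k)) (W (suc k ℕ.* 2)) (ι k) (O (suc k))))
    where
    k<q : k < q
    k<q = ℕₚ.<-≤-trans k<n (ℕₚ.m≤m*n n 2)

  -- Both sides are Σ W m xᵐ.
  expansion : ∀ x → sum< n (λ k → - ((1# + 1#) * (ι k * O (suc k))) * (x * x) ^ suc k) ≈
                    sum< q (λ i → ι i * ι i * ((1# + x) ^ suc i * (1# - x) ^ (q ∸ i)))
  expansion x = begin
    sum< n (λ k → - ((1# + 1#) * (ι k * O (suc k))) * (x * x) ^ suc k)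
      ≈⟨ sum<-cong n (λ k k<n → *-cong (W-positive k k<n) (sym (square^ x (suc k)))) ⟨
    sum< n (λ k → W (suc k ℕ.* 2) * x ^ (suc k ℕ.* 2))
      ≈⟨ +-identityˡ _ ⟨
    0# + sum< n (λ k → W (suc k ℕ.* 2) * x ^ (suc k ℕ.* 2))
      -- The missing term k = 0 can be inserted because its coefficient Σ 1 / k² vanishes.
      ≈⟨ +-congʳ (trans (*-congʳ (trans (moment-0 _) sum-ι²)) (zeroˡ _)) ⟨
    sum< (suc n) (λ k → W (k ℕ.* 2) * x ^ (k ℕ.* 2))
      ≈⟨ sum<-evens (suc n) {λ m → W m * x ^ m} (λ k → trans (*-congʳ (W-odd k)) (zeroˡ _)) ⟨
    sum< (suc n ℕ.* 2) (λ m → W m * x ^ m)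
      ≈⟨ sum<-cong (suc n ℕ.* 2) {λ m → W m * x ^ m} {λ m → sum< q (λ i → ι i * ι i * (h i m * x ^ m))} (λ m _ →
          trans (*-comm _ _) (trans (sym (sum<-*ˡ q (x ^ m) (λ i → ι i * ι i * h i m)))
           (sum<-cong q λ i _ → solve 3 (λ z u v → z :* (u :* v) := u :* (v :* z))
               refl (x ^ m) (ι i * ι i) (h i m)))) ⟩
    sum< (suc n ℕ.* 2) (λ m → sum< q (λ i → ι i * ι i * (h i m * x ^ m)))
      ≈⟨ sum<-comm (suc n ℕ.* 2) q (λ m i → ι i * ι i * (h i m * x ^ m)) ⟩
    sum< q (λ i → sum< (suc n ℕ.* 2) (λ m → ι i * ι i * (h i m * x ^ m)))
      ≈⟨ sum<-cong q (λ i i<q → trans (sum<-*ˡ (suc n ℕ.* 2) (ι i * ι i) (λ m → h i m * x ^ m))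
           (*-congˡ (trans (reflexive (≡.cong (λ N → eval N x (h i)) (≡.sym (degree i (ℕₚ.<⇒≤ i<q))))) (eval-K x
               (suc i) (q ∸ i))))) ⟩
    sum< q (λ i → ι i * ι i * ((1# + x) ^ suc i * (1# - x) ^ (q ∸ i))) ∎
    where
    degree : ∀ i → i ≤ q → suc i ℕ.+ (q ∸ i ℕ.+ 1) ≡ suc n ℕ.* 2
    degree i i≤q = ≡.cong suc (≡.trans (≡.sym (ℕₚ.+-assoc i (q ∸ i) 1))
      (≡.trans (≡.cong (ℕ._+ 1) (ℕₚ.m+[n∸m]≡n i≤q)) (ℕₚ.+-comm q 1)))

  -- Evaluation at a square root of -1/3.

  module CubeRoot (ω : Carrier) (ω-root : 1# + ω + ω * ω ≈ 0#) where

    private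
      3: : ∀ {k} → Polynomial k
      3: = :1 :+ (:1 :+ (:1 :+ con (0 , 0)))

    2<q : 2 < q
    2<q = ℕₚ.<-≤-trans (ℕₚ.n<1+n 2) (ℕₚ.≤-trans (ℕₚ.n≤1+n 3) 4≤q)

    ⅓ : Carrier
    ⅓ = ι 2

    3*⅓ : nat 3 * ⅓ ≈ 1#
    3*⅓ = ι-inverse 2 2<q

    -- Its square is -1/3 because (1 + 2 ω)² = - 3. The sign is the one for which (1 + x) / (1 - x)
    -- is - ω rather than - ω².
    x : Carrier
    x = - ((1# + (ω + ω)) * ⅓)

    x² : x * x ≈ - ⅓
    x² = ≈-from₂ ω-root 3*⅓ (solve 2 (λ w t →
      :- ((:1 :+ (w :+ w)) :* t) :* :- ((:1 :+ (w :+ w)) :* t) :- :- t :=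
      (:1 :+ 3:) :* (t :* t) :* (:1 :+ w :+ w :* w :- con (0 , 0)) :+ :- t :* (3: :* t :- :1)) refl ω ⅓)

    1+x : 1# + x ≈ - ω * (1# - x)
    1+x = ≈-from₂ ω-root 3*⅓ (solve 2 (λ w t →
      :1 :+ :- ((:1 :+ (w :+ w)) :* t) :- :- w :* (:1 :- :- ((:1 :+ (w :+ w)) :* t)) :=
      (:1 :+ :1) :* t :* (:1 :+ w :+ w :* w :- con (0 , 0)) :+ :- (:1 :+ w) :* (3: :* t :- :1)) refl ω ⅓)

    -- Brings 1 - x, up to the constants 2 and 3, to the shape 1 + y with y = - ω², to which
    -- `frobenius` applies.
    3[1-x] : (1# + (1# + 1#)) * (1# - x) ≈ (1# + 1#) * (1# - ω * ω)
    3[1-x] = ≈-from₂ ω-root 3*⅓ (solve 2 (λ w t →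
      (:1 :+ (:1 :+ :1)) :* (:1 :- :- ((:1 :+ (w :+ w)) :* t)) :- (:1 :+ :1) :* (:1 :- w :* w) :=
      (:1 :+ :1) :* (:1 :+ w :+ w :* w :- con (0 , 0)) :+ (:1 :+ (w :+ w)) :* (3: :* t :- :1)) refl ω ⅓)

    ω³ : ω * (ω * ω) ≈ 1#
    ω³ = ≈-from₁ ω-root (solve 1 (λ w → w :* (w :* w) :- :1 := (w :- :1) :* (:1 :+ w :+ w :* w :- con
        (0 , 0))) refl ω)

    w : Carrier
    w = ω ^ p

    2^p : (1# + 1#) ^ p ≈ 1# + 1#
    2^p = trans (frobenius 1#) (+-congˡ (1^≈1 p))

    3[1-x]^p : (1# + (1# + 1#)) * (1# - x) ^ p ≈ (1# + 1#) * (1# - w * w)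
    3[1-x]^p = begin
      -- The constants 3 and 2 equal their own p-th powers.
      (1# + (1# + 1#)) * (1# - x) ^ p       ≈⟨ *-congʳ (trans (frobenius (1# + 1#)) (+-congˡ 2^p)) ⟨
      (1# + (1# + 1#)) ^ p * (1# - x) ^ p   ≈⟨ ^-distrib-* _ _ p ⟨
      ((1# + (1# + 1#)) * (1# - x)) ^ p     ≈⟨ ^-congˡ p 3[1-x] ⟩
      ((1# + 1#) * (1# - ω * ω)) ^ p        ≈⟨ ^-distrib-* _ _ p ⟩
      (1# + 1#) ^ p * (1# - ω * ω) ^ p      ≈⟨ *-cong 2^p (trans (frobenius _) (+-congˡ (neg^-odd (ω * ω) n))) ⟩
      (1# + 1#) * (1# - (ω * ω) ^ p)        ≈⟨ *-congˡ (+-congˡ (-‿cong (^-distrib-* ω ω p))) ⟩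
      (1# + 1#) * (1# - w * w)              ∎

    sum-at-x : sum< q (λ i → ι i * ι i * ((1# + x) ^ suc i * (1# - x) ^ (q ∸ i))) ≈ (1# - x) ^ p * Li₂ (- ω)
    sum-at-x = trans (sum<-cong q λ i i<q → trans (*-congˡ (power i (ℕₚ.<⇒≤ i<q)))
        (solve 3 (λ a b u → a :* (b :* u) := u :* (a :* b)) refl (ι i * ι i) ((- ω) ^ suc i) ((1# - x) ^ p)))
      (sum<-*ˡ q ((1# - x) ^ p) (λ i → ι i * ι i * (- ω) ^ suc i))
      where
      power : ∀ i → i ≤ q → (1# + x) ^ suc i * (1# - x) ^ (q ∸ i) ≈ (- ω) ^ suc i * (1# - x) ^ p
      power i i≤q = begin
        (1# + x) ^ suc i * (1# - x) ^ (q ∸ i)                     ≈⟨ *-congʳ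
            (trans (^-congˡ (suc i) 1+x) (^-distrib-* (- ω) (1# - x) (suc i))) ⟩
        (- ω) ^ suc i * (1# - x) ^ suc i * (1# - x) ^ (q ∸ i)     ≈⟨ *-assoc _ _ _ ⟩
        (- ω) ^ suc i * ((1# - x) ^ suc i * (1# - x) ^ (q ∸ i))   ≈⟨ *-congˡ (^-homo-* (1# - x) (suc i) (q ∸ i)) ⟨
        (- ω) ^ suc i * (1# - x) ^ (suc i ℕ.+ (q ∸ i))            ≈⟨ *-congˡ (^-congʳ (1# - x) (≡.cong suc
            (ℕₚ.m+[n∸m]≡n i≤q))) ⟩
        (- ω) ^ suc i * (1# - x) ^ p                              ∎

    -- Replace k by p - k: ωᵖ⁻ᵏ = ωᵖ ω²ᵏ since ω³ = 1, and 1 / k² is unchanged.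
    Li₂-inversion : w * Li₂ (ω * ω) ≈ Li₂ ω
    Li₂-inversion = sym (trans (sum<-reverse q (λ i → ι i * ι i * ω ^ suc i))
      (trans (sum<-cong q flipped) (sum<-*ˡ q w (λ i → ι i * ι i * (ω * ω) ^ suc i))))
      where
      flipped : ∀ i → i < q → ι (q ∸ suc i) * ι (q ∸ suc i) * ω ^ suc (q ∸ suc i) ≈ w * (ι i * ι i * (ω * ω) ^ suc i)
      flipped i i<q = begin
        ι (q ∸ suc i) * ι (q ∸ suc i) * ω ^ suc (q ∸ suc i)
          ≈⟨ *-cong (*-cong ι-neg′ ι-neg′) (^-congʳ ω (≡.sym (ℕₚ.+-∸-assoc 1 i<q))) ⟩
        - ι i * - ι i * ω ^ (q ∸ i)
          ≈⟨ solve 2 (λ u z → :- u :* :- u :* z := u :* u :* (:1 :* z)) refl (ι i) (ω ^ (q ∸ i)) ⟩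
        ι i * ι i * (1# * ω ^ (q ∸ i))
          ≈⟨ *-congˡ (*-congʳ (trans (^-congˡ (suc i) ω³) (1^≈1 (suc i)))) ⟨
        ι i * ι i * ((ω * (ω * ω)) ^ suc i * ω ^ (q ∸ i))
          ≈⟨ *-congˡ (*-congʳ (^-distrib-* ω (ω * ω) (suc i))) ⟩
        ι i * ι i * (ω ^ suc i * (ω * ω) ^ suc i * ω ^ (q ∸ i))
          ≈⟨ solve 4 (λ u a b c → u :* (a :* b :* c) := a :* c :* (u :* b))
              refl (ι i * ι i) (ω ^ suc i) ((ω * ω) ^ suc i) (ω ^ (q ∸ i)) ⟩
        ω ^ suc i * ω ^ (q ∸ i) * (ι i * ι i * (ω * ω) ^ suc i)
          ≈⟨ *-congʳ (trans (sym (^-homo-* ω (suc i) (q ∸ i))) (^-congʳ ω (≡.cong suc (ℕₚ.m+[n∸m]≡n (ℕₚ.<⇒≤ i<q))))) ⟩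
        w * (ι i * ι i * (ω * ω) ^ suc i) ∎
        where
        ι-neg′ : ι (q ∸ suc i) ≈ - ι i
        ι-neg′ = ι-neg i (q ∸ suc i) (ℕₚ.m+[n∸m]≡n i<q)

    -- Multiplying the duplication relation at ω by 1 + w gives L(- ω) the coefficient 2 (1 - w²) =
    -- 3 (1 - x)ᵖ. Since 1 + w = - w² and w L(ω²) = L(ω), the other terms combine to - 3 w L(ω).
    harmonic-Li₂ : 1# + w + w * w ≈ 0# →
      sum< n (λ k → - ((1# + 1#) * (ι k * O (suc k))) * (- ⅓) ^ suc k) ≈ - w * Li₂ ω
    harmonic-Li₂ w-root = trans
      (trans (sum<-cong n λ k _ → *-congˡ (^-congˡ (suc k) (sym x²))) (trans (expansion x) sum-at-x))
      (cancel-nat 2 2<q (≈-from₄ 3[1-x]^p (Li₂-square ω) Li₂-inversion w-root (solve 5 (λ u m l d w →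
        3: :* (u :* m) :- 3: :* (:- w :* l) :=
        m :* ((:1 :+ (:1 :+ :1)) :* u :- (:1 :+ :1) :* (:1 :- w :* w))
        :+ :- (:1 :+ w) :* (d :- ((:1 :+ :1) :* (:1 :+ w) :* l :+ (:1 :+ :1) :* (:1 :- w) :* m))
        :+ :- w :* (w :* d :- l)
        :+ (d :- (:1 :+ :1) :* l) :* (:1 :+ w :+ w :* w :- con (0 , 0)))
        refl ((1# - x) ^ p) (Li₂ (- ω)) (Li₂ ω) (Li₂ (ω * ω)) w)))

    ω^*3 : ∀ j → ω ^ (j ℕ.* 3) ≈ 1#
    ω^*3 zero    = refl
    ω^*3 (suc j) = trans (*-congˡ (*-congˡ (*-congˡ (ω^*3 j))))
      (trans (*-congˡ (*-congˡ (*-identityʳ ω))) ω³)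

    module _ (m : ℕ) where
      square : ℕ → ℕ → Carrier
      square r j = ι (r ℕ.+ j ℕ.* 3) * ι (r ℕ.+ j ℕ.* 3)

      -- The part of Σ 1 / k² with k = 3 j + r + 1 and k ≤ 3 m; in particular `a 2` belongs to the
      -- multiples of 3.
      a : ℕ → Carrier
      a r = sum< m (square r)

      blocks : ∀ f → sum< (m ℕ.* 3) f ≈ sum< m (λ j → f (j ℕ.* 3)) + sum< m (λ j → f (1 ℕ.+ j ℕ.* 3)) + sum< m
          (λ j → f (2 ℕ.+ j ℕ.* 3))
      blocks f = trans (sum<-blocks m 3 f) (trans (sum<-cong m λ j _ →
        solve 3 (λ a b c → a :+ (b :+ (c :+ con (0 , 0))) := a :+ b :+ c)
            refl (f (j ℕ.* 3)) (f (1 ℕ.+ j ℕ.* 3)) (f (2 ℕ.+ j ℕ.* 3)))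
        (trans (sum<-+ m _ _) (+-congʳ (sum<-+ m _ _))))

      sum-blocks : sum< (m ℕ.* 3) (λ i → ι i * ι i) ≈ a 0 + a 1 + a 2
      sum-blocks = blocks (λ i → ι i * ι i)

      Li₂-blocks : sum< (m ℕ.* 3) (λ i → ι i * ι i * ω ^ suc i) ≈ ω * a 0 + ω * ω * a 1 + a 2
      Li₂-blocks = trans (blocks (λ i → ι i * ι i * ω ^ suc i)) (+-cong (+-cong
        (trans (sum<-cong m λ j _ → trans (*-congˡ (*-congˡ (ω^*3 j))) (solve 2 (λ u z → u :* (z :* :1) := z :* u)
            refl (square 0 j) ω)) (sum<-*ˡ m ω (square 0)))
        (trans (sum<-cong m λ j _ → trans (*-congˡ (*-congˡ (*-congˡ (ω^*3 j))))
            (solve 2 (λ u z → u :* (z :* (z :* :1)) := z :* z :* u)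
                refl (square 1 j) ω)) (sum<-*ˡ m (ω * ω) (square 1))))
        (sum<-cong m λ j _ → trans (*-congˡ (ω^*3 (suc j))) (*-identityʳ _)))

      -- The hypothesis amounts to p = 3 m + r + 1, so k ↦ p - k sends the multiples of 3 to the
      -- class of r + 1.
      reflection : ∀ r → suc r ℕ.+ 2 ℕ.+ m ℕ.* 3 ≡ 3 ℕ.+ q → a 2 ≈ a r
      reflection r eq = trans (sum<-reverse m (square 2)) (sum<-cong m λ j j<m →
        let neg = ι-neg (r ℕ.+ j ℕ.* 3) (2 ℕ.+ (m ∸ suc j) ℕ.* 3) (index j j<m) in
        trans (*-cong neg neg) (solve 1 (λ u → :- u :* :- u := u :* u) refl (ι (r ℕ.+ j ℕ.* 3))))
        where
        open import Data.Nat.Solver using (module +-*-Solver)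
        index : ∀ j → j < m → suc (r ℕ.+ j ℕ.* 3 ℕ.+ (2 ℕ.+ (m ∸ suc j) ℕ.* 3)) ≡ q
        index j j<m = ℕₚ.+-cancelˡ-≡ 3 _ _ (≡.trans
          (N.solve 3 (λ r j d → N.con 3 N.:+ (N.con 1 N.:+ (r N.:+ j N.:* N.con 3 N.:+ (N.con 2 N.:+ d N.:* N.con 3)))
             N.:= N.con 1 N.:+ r N.:+ N.con 2 N.:+ (N.con 1 N.:+ j N.:+ d) N.:* N.con 3) ≡.refl r j (m ∸ suc j))
          (≡.trans (≡.cong (λ k → suc r ℕ.+ 2 ℕ.+ k ℕ.* 3) (ℕₚ.m+[n∸m]≡n j<m)) eq))
          where module N = +-*-Solver

      a-2 : m ℕ.* 3 ≤ q → a 2 ≈ ⅓ * ⅓ * sum< m (λ j → ι j * ι j)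
      a-2 m*3≤q = trans (sum<-cong m λ j j<m → trans (*-cong (third j j<m) (third j j<m))
          (solve 2 (λ t u → t :* u :* (t :* u) := t :* t :* (u :* u)) refl ⅓ (ι j)))
        (sum<-*ˡ m (⅓ * ⅓) (λ j → ι j * ι j))
        where
        nat-*3 : ∀ j → nat (j ℕ.* 3) ≈ nat 3 * nat j
        nat-*3 zero    = sym (zeroʳ _)
        nat-*3 (suc j) = trans (+-congˡ (+-congˡ (+-congˡ (nat-*3 j))))
          (solve 1 (λ k → :1 :+ (:1 :+ (:1 :+ 3: :* k)) := 3: :* (:1 :+ k)) refl (nat j))
        third : ∀ j → j < m → ι (2 ℕ.+ j ℕ.* 3) ≈ ⅓ * ι j
        third j j<m = cancel-nat (2 ℕ.+ j ℕ.* 3) 2+3j<q (≈-from₄ (ι-inverse (2 ℕ.+ j ℕ.* 3) 2+3j<q)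
          (ι-inverse j (ℕₚ.≤-<-trans (ℕₚ.≤-trans (ℕₚ.m≤m*n j 3) (ℕₚ.m≤n+m (j ℕ.* 3) 2)) 2+3j<q)) 3*⅓ (nat-*3 j)
          (solve 5 (λ l k u v t →
            (:1 :+ (:1 :+ (:1 :+ l))) :* u :- (:1 :+ (:1 :+ (:1 :+ l))) :* (t :* v) :=
            :1 :* ((:1 :+ (:1 :+ (:1 :+ l))) :* u :- :1) :+ :- (3: :* t) :* ((:1 :+ k) :* v :- :1)
            :+ :- :1 :* (3: :* t :- :1) :+ :- (t :* v) :* (l :- 3: :* k))
            refl (nat (j ℕ.* 3)) (nat j) (ι (2 ℕ.+ j ℕ.* 3)) (ι j) ⅓))
          where
          2+3j<q : 2 ℕ.+ j ℕ.* 3 < q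
          2+3j<q = ℕₚ.≤-trans (ℕₚ.*-monoˡ-≤ 3 j<m) m*3≤q

    Sum-identity : ℕ → Set ℓ
    Sum-identity m = sum< n (λ k → - ((1# + 1#) * (ι k * O (suc k))) * (- ⅓) ^ suc k) ≈
                     ⅓ * sum< m (λ j → ι j * ι j)

    3a≈ : ∀ m → m ℕ.* 3 ≤ q → nat 3 * a m 2 ≈ ⅓ * sum< m (λ j → ι j * ι j)
    3a≈ m m*3≤q = ≈-from₂ (a-2 m m*3≤q) 3*⅓ (solve 3 (λ b t s → 3: :* b :- t :* s :=
      3: :* (b :- t :* t :* s) :+ t :* s :* (3: :* t :- :1)) refl (a m 2) ⅓ (sum< m (λ j → ι j * ι j)))

    -- Here p ≡ 1 mod 3 and ωᵖ = ω. With c = `a m 2`, reflection gives c for the class of 1, and the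
    -- vanishing total leaves - 2 c for the class of 2. So - ω L(ω) = - ω (ω - 2 ω² + 1) c = 3 c.
    sum-identity₁ : ∀ m → q ≡ m ℕ.* 3 → Sum-identity m
    sum-identity₁ m q≡3m = trans (harmonic-Li₂ (trans (+-cong (+-congˡ w≈ω) (*-cong w≈ω w≈ω)) ω-root))
      (trans (*-cong (-‿cong w≈ω) L≈) (trans
        (≈-from₃ total (reflection m 0 (≡.cong (3 ℕ.+_) (≡.sym q≡3m))) ω-root (solve 4 (λ z a b c →
          :- z :* (z :* a :+ z :* z :* b :+ c) :- 3: :* c :=
          :- (z :* z :* z) :* (a :+ b :+ c :- con (0 , 0)) :+ (z :* z :- z :* z :* z) :* (c :- a)
          :+ (z :+ z :- 3:) :* c :* (:1 :+ z :+ z :* z :- con (0 , 0)))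
          refl ω (a m 0) (a m 1) (a m 2)))
        (3a≈ m (ℕₚ.≤-reflexive (≡.sym q≡3m)))))
      where
      w≈ω : w ≈ ω
      w≈ω = trans (^-congʳ ω (≡.cong suc q≡3m)) (trans (*-congˡ (ω^*3 m)) (*-identityʳ ω))
      total : a m 0 + a m 1 + a m 2 ≈ 0#
      total = trans (sym (sum-blocks m)) (trans (reflexive (≡.cong (λ k → sum< k (λ i → ι i * ι i))
          (≡.sym q≡3m))) sum-ι²)
      L≈ : Li₂ ω ≈ ω * a m 0 + ω * ω * a m 1 + a m 2
      L≈ = trans (reflexive (≡.cong (λ k → sum< k (λ i → ι i * ι i * ω ^ suc i)) q≡3m)) (Li₂-blocks m)

    -- Here p ≡ 2 mod 3 and ωᵖ = ω². Reflection gives c for the class of 2 and leaves - 2 c for the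
    -- class of 1, so - ω² L(ω) = - ω² (- 2 ω + ω² + 1) c = 3 c.
    sum-identity₂ : ∀ m → q ≡ suc (m ℕ.* 3) → Sum-identity m
    sum-identity₂ m q≡1+3m = trans (harmonic-Li₂ (≈-from₂ w≈ω² ω-root (solve 2 (λ w z →
        :1 :+ w :+ w :* w :- con (0 , 0) := (:1 :+ w :+ z :* z) :* (w :- z :* z)
        :+ (:1 :- z :+ z :* z) :* (:1 :+ z :+ z :* z :- con (0 , 0))) refl w ω)))
      (trans (*-cong (-‿cong w≈ω²) L≈) (trans
        (≈-from₃ total (reflection m 1 (≡.cong (3 ℕ.+_) (≡.sym q≡1+3m))) ω-root (solve 4 (λ z a b c →
          :- (z :* z) :* (z :* a :+ z :* z :* b :+ c) :- 3: :* c :=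
          :- (z :* z :* z) :* (a :+ b :+ c :- con (0 , 0)) :+ (z :* z :* z :* z :- z :* z :* z) :* (c :- b)
          :+ (3: :* (z :- :1) :- z :* z) :* c :* (:1 :+ z :+ z :* z :- con (0 , 0)))
          refl ω (a m 0 + last) (a m 1) (a m 2)))
        (3a≈ m (ℕₚ.≤-trans (ℕₚ.n≤1+n _) (ℕₚ.≤-reflexive (≡.sym q≡1+3m))))))
      where
      -- The term k = 3 m + 1 = p - 1, left over by the blocks of three; it belongs to the class of
      -- 1.
      last : Carrier
      last = ι (m ℕ.* 3) * ι (m ℕ.* 3)
      w≈ω² : w ≈ ω * ω
      w≈ω² = trans (^-congʳ ω (≡.cong suc q≡1+3m)) (*-congˡ (trans (*-congˡ (ω^*3 m)) (*-identityʳ ω)))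
      total : a m 0 + last + a m 1 + a m 2 ≈ 0#
      total = trans (solve 4 (λ a l b c → a :+ l :+ b :+ c := a :+ b :+ c :+ l) refl (a m 0) last (a m 1) (a m 2))
        (trans (+-congʳ (sym (sum-blocks m))) (trans (sym (sum<-last (m ℕ.* 3) (λ i → ι i * ι i)))
        (trans (reflexive (≡.cong (λ k → sum< k (λ i → ι i * ι i)) (≡.sym q≡1+3m))) sum-ι²)))
      L≈ : Li₂ ω ≈ ω * (a m 0 + last) + ω * ω * a m 1 + a m 2
      L≈ = trans (reflexive (≡.cong (λ k → sum< k (λ i → ι i * ι i * ω ^ suc i)) q≡1+3m))
        (trans (sum<-last (m ℕ.* 3) (λ i → ι i * ι i * ω ^ suc i))
        (trans (+-cong (Li₂-blocks m) (*-congˡ (trans (*-congˡ (ω^*3 m)) (*-identityʳ ω))))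
        (solve 5 (λ z a b c l → z :* a :+ z :* z :* b :+ c :+ l :* z := z :* (a :+ l) :+ z :* z :* b :+ c)
          refl ω (a m 0) (a m 1) (a m 2) last)))

-- Adjoining a primitive cube root of unity.

module AdjoinCubeRoot {c ℓ} (R : CommutativeRing c ℓ) where
  open CommutativeRing R hiding (zero)
  open IntegerCoefficientSolver R

  additive = DirectProduct.abelianGroup +-abelianGroup +-abelianGroup

  -- (a , b) stands for a + b ω, where ω² = - 1 - ω.
  R[ω] : CommutativeRing c ℓ
  R[ω] = record
    { Carrier = Carrier × Carrier
    ; _≈_ = λ x y → proj₁ x ≈ proj₁ y × proj₂ x ≈ proj₂ y
    ; _+_ = λ { (a , b) (c , d) → a + c , b + d }
    ; _*_ = λ { (a , b) (c , d) → a * c - b * d , a * d + b * c - b * d }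
    ; -_ = λ { (a , b) → - a , - b }
    ; 0# = 0# , 0#
    ; 1# = 1# , 0#
    ; isCommutativeRing = record
      { isRing = record
        { +-isAbelianGroup = AbelianGroup.isAbelianGroup additive
        ; *-cong = λ { (p , q) (r , s) → +-cong (*-cong p r) (-‿cong (*-cong q s))
                                       , +-cong (+-cong (*-cong p s) (*-cong q r)) (-‿cong (*-cong q s)) }
        ; *-assoc = λ { (a , b) (c , d) (e , f) →
            solve 6 (λ a b c d e f → (a :* c :- b :* d) :* e :- (a :* d :+ b :* c :- b :* d) :* f
              := a :* (c :* e :- d :* f) :- b :* (c :* f :+ d :* e :- d :* f)) refl a b c d e f
          , solve 6 (λ a b c d e f →
              (a :* c :- b :* d) :* f :+ (a :* d :+ b :* c :- b :* d) :* e :- (a :* d :+ b :* c :- b :* d) :* f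
              := a :* (c :* f :+ d :* e :- d :* f) :+ b :* (c :* e :- d :* f) :- b :* (c :* f :+ d :* e :- d :* f))
              refl a b c d e f }
        ; *-identity =
            (λ { (a , b) →
              solve 2 (λ a b → :1 :* a :- :0 :* b := a) refl a b
            , solve 2 (λ a b → :1 :* b :+ :0 :* a :- :0 :* b := b) refl a b })
          , (λ { (a , b) →
              solve 2 (λ a b → a :* :1 :- b :* :0 := a) refl a b
            , solve 2 (λ a b → a :* :0 :+ b :* :1 :- b :* :0 := b) refl a b })
        ; distrib =
            (λ { (a , b) (c , d) (e , f) →
              solve 6 (λ a b c d e f → a :* (c :+ e) :- b :* (d :+ f)
                  := a :* c :- b :* d :+ (a :* e :- b :* f)) refl a b c d e f
            , solve 6 (λ a b c d e f → a :* (d :+ f) :+ b :* (c :+ e) :- b :* (d :+ f)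
                := a :* d :+ b :* c :- b :* d :+ (a :* f :+ b :* e :- b :* f)) refl a b c d e f })
          , (λ { (a , b) (c , d) (e , f) →
              solve 6 (λ a b c d e f → (c :+ e) :* a :- (d :+ f) :* b
                  := c :* a :- d :* b :+ (e :* a :- f :* b)) refl a b c d e f
            , solve 6 (λ a b c d e f → (c :+ e) :* b :+ (d :+ f) :* a :- (d :+ f) :* b
                := c :* b :+ d :* a :- d :* b :+ (e :* b :+ f :* a :- f :* b)) refl a b c d e f })
        }
      ; *-comm = λ { (a , b) (c , d) →
            solve 4 (λ a b c d → a :* c :- b :* d := c :* a :- d :* b) refl a b c d
          , solve 4 (λ a b c d → a :* d :+ b :* c :- b :* d := c :* b :+ d :* a :- d :* b) refl a b c d }
      }
    }
    where
    :0 : ∀ {n} → Polynomial n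
    :0 = con (0 , 0)

  private
    module E = CommutativeRing R[ω]
    module E^ where
      open import Algebra.Properties.Semiring.Exp E.semiring public
  open import Algebra.Properties.Semiring.Exp semiring
  open Expansion R using (nat)
  open InitialSums R using (sum<)

  ω : E.Carrier
  ω = 0# , 1#

  ω-root : E.1# E.+ ω E.+ ω E.* ω E.≈ E.0#
  ω-root = solve 0 (:1 :+ :0 :+ (:0 :* :0 :- :1 :* :1) := :0) refl
         , solve 0 (:0 :+ :1 :+ (:0 :* :1 :+ :1 :* :0 :- :1 :* :1) := :0) refl
    where
    :0 : ∀ {n} → Polynomial n
    :0 = con (0 , 0)

  embed : Carrier → E.Carrier
  embed a = a , 0#

  embed-+ : ∀ a b → embed (a + b) E.≈ embed a E.+ embed b
  embed-+ a b = refl , sym (+-identityˡ 0#)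

  embed-* : ∀ a b → embed (a * b) E.≈ embed a E.* embed b
  embed-* a b = solve 2 (λ a b → a :* b := a :* b :- con (0 , 0) :* con (0 , 0)) refl a b
              , solve 2 (λ a b → con (0 , 0) := a :* con (0 , 0) :+ con (0 , 0) :* b :- con (0 , 0) :* con
                  (0 , 0)) refl a b

  embed-neg : ∀ a → embed (- a) E.≈ E.- embed a
  embed-neg a = refl , solve 0 (con (0 , 0) := :- con (0 , 0)) refl

  embed-^ : ∀ a n → embed (a ^ n) E.≈ embed a E^.^ n
  embed-^ a zero    = E.refl
  embed-^ a (suc n) = E.trans (embed-* a (a ^ n)) (E.*-congˡ {embed a} (embed-^ a n))

  embed-nat : ∀ n → embed (nat n) E.≈ Expansion.nat R[ω] n
  embed-nat zero    = E.refl
  embed-nat (suc n) = E.trans (embed-+ 1# (nat n)) (E.+-congˡ {E.1#} (embed-nat n))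

  embed-sum : ∀ n f → embed (sum< n f) E.≈ InitialSums.sum< R[ω] n (λ i → embed (f i))
  embed-sum zero    f = E.refl
  embed-sum (suc n) f = E.trans (embed-+ (f 0) _) (E.+-congˡ {embed (f 0)} (embed-sum n (λ i → f (suc i))))

-- Descent of the identity to the base ring.

module CharacteristicIdentity {c ℓ} (R : CommutativeRing c ℓ) (n : ℕ) (2≤n : 2 ≤ n)
  (p≈0 : CommutativeRing._≈_ R (Expansion.nat R (suc (n ℕ.* 2))) (CommutativeRing.0# R))
  (ι : ℕ → CommutativeRing.Carrier R)
  (ι-inverse : ∀ i → i < n ℕ.* 2 →
     CommutativeRing._≈_ R (CommutativeRing._*_ R (Expansion.nat R (suc i)) (ι i)) (CommutativeRing.1# R))
  where
  open CommutativeRing R hiding (zero)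
  open import Algebra.Properties.Semiring.Exp semiring
  open InitialSums R using (sum<)
  open AdjoinCubeRoot R
  private
    module E = CommutativeRing R[ω]
    module S = InitialSums R[ω]
    module C = Characteristic R[ω] n 2≤n
      (E.trans (E.sym (embed-nat (suc (n ℕ.* 2)))) (p≈0 , refl))
      (λ i → embed (ι i))
      (λ i i<q → E.trans (E.*-congʳ {embed (ι i)} (E.sym (embed-nat (suc i))))
        (E.trans (E.sym (embed-* (Expansion.nat R (suc i)) (ι i))) (ι-inverse i i<q , refl)))
    module P where
      open import Algebra.Properties.Semiring.Exp E.semiring public
  open C.CubeRoot ω ω-root using (Sum-identity; sum-identity₁; sum-identity₂)

  O : ℕ → Carrier
  O k = sum< k (λ j → ι (j ℕ.* 2))

  harmonicSum : Carrier
  harmonicSum = sum< n (λ k → - ((1# + 1#) * (ι k * O (suc k))) * (- ι 2) ^ suc k)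

  -- Both sides are embedded elements, and equality of pairs is componentwise, so the first
  -- projection gives the identity in the base ring.
  descend : ∀ m → Sum-identity m → harmonicSum ≈ ι 2 * sum< m (λ j → ι j * ι j)
  descend m eq = proj₁ (E.trans lhs (E.trans eq (E.sym rhs)))
    where
    term : ∀ k → embed (- ((1# + 1#) * (ι k * O (suc k))) * (- ι 2) ^ suc k) E.≈
                 (E.- ((E.1# E.+ E.1#) E.* (embed (ι k) E.* C.O (suc k)))) E.* ((E.- embed (ι 2)) P.^ suc k)
    term k = E.trans (embed-* _ ((- ι 2) ^ suc k)) (E.*-cong
      (E.trans (embed-neg _) (E.-‿cong (E.trans (embed-* _ (ι k * O (suc k)))
        (E.*-cong (embed-+ 1# 1#) (E.trans (embed-* (ι k) (O (suc k))) (E.*-congˡ {embed (ι k)} (embed-sum (suc k)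
            (λ j → ι (j ℕ.* 2)))))))))
      (E.trans (embed-^ (- ι 2) (suc k)) (P.^-congˡ (suc k) (embed-neg (ι 2)))))
    lhs : embed harmonicSum E.≈ S.sum< n _
    lhs = E.trans (embed-sum n _) (S.sum<-cong n λ k _ → term k)
    rhs : embed (ι 2 * sum< m (λ j → ι j * ι j)) E.≈ embed (ι 2) E.* S.sum< m (λ j → embed (ι j) E.* embed (ι j))
    rhs = E.trans (embed-* (ι 2) (sum< m (λ j → ι j * ι j))) (E.*-congˡ {embed (ι 2)} (E.trans (embed-sum m _)
        (S.sum<-cong m λ j _ → embed-* (ι j) (ι j))))

  harmonicSum-≡1 : ∀ m → n ℕ.* 2 ≡ m ℕ.* 3 → harmonicSum ≈ ι 2 * sum< m (λ j → ι j * ι j)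
  harmonicSum-≡1 m eq = descend m (sum-identity₁ m eq)

  harmonicSum-≡2 : ∀ m → n ℕ.* 2 ≡ suc (m ℕ.* 3) → harmonicSum ≈ ι 2 * sum< m (λ j → ι j * ι j)
  harmonicSum-≡2 m eq = descend m (sum-identity₂ m eq)

open import Defs
open import Data.Empty using (⊥-elim)
open import Data.Fin.Base using (zero; suc)
open import Data.Integer.Base as ℤ using (ℤ; +_; -[1+_]; +0)
import Data.Integer.Properties as ℤₚ
open import Data.Nat.Coprimality as Coprimality
  using (Coprime; coprime-divisor; coprime?; prime⇒coprime)
open import Data.Nat.Divisibility using (_∣_; divides; ∣-trans)
open import Data.Nat.DivMod using (_mod_; _divMod_; m*n/n≡m; DivMod)
open import Data.Nat.Primality using (Prime; composite)
open import Data.Rational.Base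
  using (ℚ; mkℚ; NonZero; ↧ₙ_; 0ℚ; 1ℚ; _+_; _*_; _-_; -_; _÷_; 1/_)
open import Data.Rational.Literals using (fromℤ)
open import Data.Rational.Properties
  using (+-*-commutativeRing; toℚᵘ-injective; toℚᵘ-homo-+; toℚᵘ-homo-*; toℚᵘ-cong; *-inverseˡ; *-inverseʳ)
open import Data.Rational.Unnormalised.Base using (*≡*)
import Data.Rational.Unnormalised.Properties as ℚᵘₚ
open import Relation.Binary.PropositionalEquality

-- The ring of p-integral rationals modulo p.

module ℚᴿ = CommutativeRing +-*-commutativeRing
module ℚ-Solver = IntegerCoefficientSolver +-*-commutativeRing

open ≡-Reasoning
open ℚ-Solver using (solve; _:+_; _:*_; _:-_; :-_; _:=_; con; :1; ≈-from₁; ≈-from₂)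

fromℤ-* : ∀ a b → fromℤ (a ℤ.* b) ≡ fromℤ a * fromℤ b
fromℤ-* a b = toℚᵘ-injective (ℚᵘₚ.≃-sym (toℚᵘ-homo-* (fromℤ a) (fromℤ b)))

fromℤ-+ : ∀ a b → fromℤ (a ℤ.+ b) ≡ fromℤ a + fromℤ b
fromℤ-+ a b = toℚᵘ-injective (ℚᵘₚ.≃-sym (ℚᵘₚ.≃-trans (toℚᵘ-homo-+ (fromℤ a) (fromℤ b))
  (*≡* (cong (ℤ._* + 1) (cong₂ ℤ._+_ (ℤₚ.*-identityʳ a) (ℤₚ.*-identityʳ b))))))

fromℕ : ℕ → ℚ
fromℕ n = fromℤ (+ n)

fromℕ-* : ∀ m n → fromℕ (m ℕ.* n) ≡ fromℕ m * fromℕ n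
fromℕ-* m n = trans (cong fromℤ (ℤₚ.pos-* m n)) (fromℤ-* (+ m) (+ n))

-- With q = n / e in lowest terms, n d = z e, and e is coprime to n.
denominator-∣ : ∀ q d z → q * fromℕ d ≡ fromℤ z → ↧ₙ q ∣ d
denominator-∣ q@(mkℚ n e-1 coprime) d z eq
  with *≡* eq′ ← ℚᵘₚ.≃-trans (ℚᵘₚ.≃-sym (toℚᵘ-homo-* q (fromℕ d))) (toℚᵘ-cong eq)
  = coprime-divisor (Coprimality.sym (Coprimality.recompute coprime)) (divides ℤ.∣ z ∣ (begin
      ℤ.∣ n ∣ ℕ.* d                  ≡⟨ ℤₚ.abs-* n (+ d) ⟨
      ℤ.∣ n ℤ.* + d ∣                ≡⟨ cong ℤ.∣_∣ (ℤₚ.*-identityʳ (n ℤ.* + d)) ⟨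
      ℤ.∣ n ℤ.* + d ℤ.* + 1 ∣        ≡⟨ cong ℤ.∣_∣ eq′ ⟩
      ℤ.∣ z ℤ.* + (suc e-1 ℕ.* 1) ∣  ≡⟨ cong (λ k → ℤ.∣ z ℤ.* + k ∣) (ℕₚ.*-identityʳ (suc e-1)) ⟩
      ℤ.∣ z ℤ.* + suc e-1 ∣          ≡⟨ ℤₚ.abs-* z (+ suc e-1) ⟩
      ℤ.∣ z ∣ ℕ.* suc e-1            ∎))

module Localisation (p : ℕ) where

  -- Any denominator coprime to p is allowed, reduced or not, so that sums and products need no
  -- normalisation; `integral⇒coprime` returns to lowest terms.
  record Integral (q : ℚ) : Set where
    constructor integral
    field
      denominator : ℕ
      numerator   : ℤ
      coprime     : Coprime denominator p
      clears      : q * fromℕ denominator ≡ fromℤ numerator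

  integral⇒coprime : ∀ {q} → Integral q → Coprime (↧ₙ q) p
  integral⇒coprime {q} (integral d z c eq) (k∣↧q , k∣p) = c (∣-trans k∣↧q (denominator-∣ q d z eq) , k∣p)

  coprime-* : ∀ {d e} → Coprime d p → Coprime e p → Coprime (d ℕ.* e) p
  coprime-* c c′ (k∣de , k∣p) =
    c′ (coprime-divisor (λ { (l∣k , l∣d) → c (l∣d , ∣-trans l∣k k∣p) }) k∣de , k∣p)

  integral-fromℤ : ∀ z → Integral (fromℤ z)
  integral-fromℤ z = integral 1 z (Coprimality.1-coprimeTo p) (ℚᴿ.*-identityʳ (fromℤ z))

  integral-+ : ∀ {q r} → Integral q → Integral r → Integral (q + r)
  integral-+ {q} {r} (integral d y c eq) (integral e z c′ eq′) =
    integral (d ℕ.* e) (y ℤ.* + e ℤ.+ z ℤ.* + d) (coprime-* c c′) (begin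
      (q + r) * fromℕ (d ℕ.* e)                 ≡⟨ cong ((q + r) *_) (fromℕ-* d e) ⟩
      (q + r) * (fromℕ d * fromℕ e)             ≡⟨ solve 4 (λ q r d e → (q :+ r) :* (d :* e)
          := q :* d :* e :+ r :* e :* d) refl q r (fromℕ d) (fromℕ e) ⟩
      q * fromℕ d * fromℕ e + r * fromℕ e * fromℕ d ≡⟨ cong₂ (λ u v → u * fromℕ e + v * fromℕ d) eq eq′ ⟩
      fromℤ y * fromℕ e + fromℤ z * fromℕ d     ≡⟨ cong₂ _+_ (fromℤ-* y (+ e)) (fromℤ-* z (+ d)) ⟨
      fromℤ (y ℤ.* + e) + fromℤ (z ℤ.* + d)     ≡⟨ fromℤ-+ (y ℤ.* + e) (z ℤ.* + d) ⟨
      fromℤ (y ℤ.* + e ℤ.+ z ℤ.* + d)           ∎)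

  integral-* : ∀ {q r} → Integral q → Integral r → Integral (q * r)
  integral-* {q} {r} (integral d y c eq) (integral e z c′ eq′) = integral (d ℕ.* e) (y ℤ.* z) (coprime-* c c′) (begin
      q * r * fromℕ (d ℕ.* e)              ≡⟨ cong (q * r *_) (fromℕ-* d e) ⟩
      q * r * (fromℕ d * fromℕ e)          ≡⟨ solve 4 (λ q r d e → q :* r :* (d :* e)
          := q :* d :* (r :* e)) refl q r (fromℕ d) (fromℕ e) ⟩
      q * fromℕ d * (r * fromℕ e)          ≡⟨ cong₂ _*_ eq eq′ ⟩
      fromℤ y * fromℤ z                    ≡⟨ fromℤ-* y z ⟨
      fromℤ (y ℤ.* z)                      ∎)

  integral-neg : ∀ {q} → Integral q → Integral (- q)
  integral-neg {q} i = subst Integral (solve 1 (λ q → :- :1 :* q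
      := :- q) refl q) (integral-* (integral-fromℤ -[1+ 0 ]) i)

  integral-1/ : ∀ k .{{_ : NonZero (fromℕ k)}} → Coprime k p → Integral (1/ fromℕ k)
  integral-1/ k c = integral k (+ 1) c (*-inverseˡ (fromℕ k))

  infix 4 _≡ₚ_
  record _≡ₚ_ (a b : ℚ) : Set where
    constructor congruent
    field
      quotient    : ℚ
      integrality : Integral quotient
      difference  : a - b ≡ fromℕ p * quotient

  ≡⇒≡ₚ : ∀ {a b} → a ≡ b → a ≡ₚ b
  ≡⇒≡ₚ {a} refl = congruent 0ℚ (integral-fromℤ +0) (solve 2 (λ a p → a :- a := p :* con (0 , 0)) refl a (fromℕ p))

  ≡ₚ-sym : ∀ {a b} → a ≡ₚ b → b ≡ₚ a
  ≡ₚ-sym {a} {b} (congruent r i eq) = congruent (- r) (integral-neg i) (≈-from₁ {c = - 1ℚ} eq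
    (solve 4 (λ a b p r → b :- a :- p :* :- r := :- :1 :* (a :- b :- p :* r)) refl a b (fromℕ p) r))

  ≡ₚ-trans : ∀ {a b c} → a ≡ₚ b → b ≡ₚ c → a ≡ₚ c
  ≡ₚ-trans {a} {b} {c} (congruent r i eq) (congruent s j eq′) = congruent (r + s) (integral-+ i j)
      (≈-from₂ {c = 1ℚ} {c′ = 1ℚ} eq eq′
    (solve 6 (λ a b c p r s → a :- c :- p :* (r :+ s) := :1 :* (a :- b :- p :* r) :+ :1 :* (b :- c :- p :* s))
      refl a b c (fromℕ p) r s))

  ≡ₚ-+ : ∀ {a b c d} → a ≡ₚ b → c ≡ₚ d → a + c ≡ₚ b + d
  ≡ₚ-+ {a} {b} {c} {d} (congruent r i eq) (congruent s j eq′) = congruent (r + s) (integral-+ i j)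
      (≈-from₂ {c = 1ℚ} {c′ = 1ℚ} eq eq′
    (solve 7 (λ a b c d p r s → a :+ c :- (b :+ d) :- p :* (r :+ s)
        := :1 :* (a :- b :- p :* r) :+ :1 :* (c :- d :- p :* s))
      refl a b c d (fromℕ p) r s))

  ≡ₚ-* : ∀ {a b c d} → Integral b → Integral c → a ≡ₚ b → c ≡ₚ d → a * c ≡ₚ b * d
  ≡ₚ-* {a} {b} {c} {d} ib ic (congruent r i eq) (congruent s j eq′) =
    congruent (r * c + b * s) (integral-+ (integral-* i ic) (integral-* ib j)) (≈-from₂ {c = c} {c′ = b} eq eq′
    (solve 7 (λ a b c d p r s → a :* c :- b :* d :- p :* (r :* c :+ b :* s)
        := c :* (a :- b :- p :* r) :+ b :* (c :- d :- p :* s))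
      refl a b c d (fromℕ p) r s))

  ≡ₚ-neg : ∀ {a b} → a ≡ₚ b → - a ≡ₚ - b
  ≡ₚ-neg {a} {b} (congruent r i eq) = congruent (- r) (integral-neg i) (≈-from₁ {c = - 1ℚ} eq
    (solve 4 (λ a b p r → :- a :- :- b :- p :* :- r := :- :1 :* (a :- b :- p :* r)) refl a b (fromℕ p) r))

  -- ℤ/p, as ℤ₍ₚ₎ with congruence modulo p for its equality.
  residues : CommutativeRing _ _
  residues = record
    { Carrier = Σ ℚ Integral
    ; _≈_ = λ x y → proj₁ x ≡ₚ proj₁ y
    ; _+_ = λ x y → proj₁ x + proj₁ y , integral-+ (proj₂ x) (proj₂ y)
    ; _*_ = λ x y → proj₁ x * proj₁ y , integral-* (proj₂ x) (proj₂ y)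
    ; -_ = λ x → - proj₁ x , integral-neg (proj₂ x)
    ; 0# = 0ℚ , integral-fromℤ +0
    ; 1# = 1ℚ , integral-fromℤ (+ 1)
    ; isCommutativeRing = record
      { isRing = record
        { +-isAbelianGroup = record
          { isGroup = record
            { isMonoid = record
              { isSemigroup = record
                { isMagma = record
                  { isEquivalence = record { refl = ≡⇒≡ₚ refl ; sym = ≡ₚ-sym ; trans = ≡ₚ-trans }
                  ; ∙-cong = ≡ₚ-+
                  }
                ; assoc = λ x y z → ≡⇒≡ₚ (ℚᴿ.+-assoc (proj₁ x) (proj₁ y) (proj₁ z))
                }
              ; identity = (λ x → ≡⇒≡ₚ (ℚᴿ.+-identityˡ (proj₁ x))) , (λ x → ≡⇒≡ₚ (ℚᴿ.+-identityʳ (proj₁ x)))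
              }
            ; inverse = (λ x → ≡⇒≡ₚ (ℚᴿ.-‿inverseˡ (proj₁ x))) , (λ x → ≡⇒≡ₚ (ℚᴿ.-‿inverseʳ (proj₁ x)))
            ; ⁻¹-cong = ≡ₚ-neg
            }
          ; comm = λ x y → ≡⇒≡ₚ (ℚᴿ.+-comm (proj₁ x) (proj₁ y))
          }
        ; *-cong = λ {x} {y} {u} {v} → ≡ₚ-* (proj₂ y) (proj₂ u)
        ; *-assoc = λ x y z → ≡⇒≡ₚ (ℚᴿ.*-assoc (proj₁ x) (proj₁ y) (proj₁ z))
        ; *-identity = (λ x → ≡⇒≡ₚ (ℚᴿ.*-identityˡ (proj₁ x))) , (λ x → ≡⇒≡ₚ (ℚᴿ.*-identityʳ (proj₁ x)))
        ; distrib = (λ x y z → ≡⇒≡ₚ (ℚᴿ.distribˡ (proj₁ x) (proj₁ y) (proj₁ z)))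
                  , (λ x y z → ≡⇒≡ₚ (ℚᴿ.distribʳ (proj₁ x) (proj₁ y) (proj₁ z)))
        }
      ; *-comm = λ x y → ≡⇒≡ₚ (ℚᴿ.*-comm (proj₁ x) (proj₁ y))
      }
    }

-- The summands in terms of sums of odd reciprocals.

module ℚ-Sums = InitialSums +-*-commutativeRing
open ℚ-Sums using (sum<; sum<-∑; sum<-+; sum<-cong; sum<-last; sum<-*ˡ)

fromℕ-suc : ∀ k → fromℕ (suc k) ≡ 1ℚ + fromℕ k
fromℕ-suc k = fromℤ-+ (+ 1) (+ k)

inv : ℕ → ℚ
inv k = 1/ fromℕ (suc k)

inv-inverse : ∀ k → fromℕ (suc k) * inv k ≡ 1ℚ
inv-inverse k = *-inverseʳ (fromℕ (suc k))

÷-unique : ∀ x y z .{{_ : NonZero y}} → z * y ≡ x → x ÷ y ≡ z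
÷-unique x y z refl = trans (ℚᴿ.*-assoc z y (1/ y)) (trans (cong (z *_) (*-inverseʳ y)) (ℚᴿ.*-identityʳ z))

oddSum : ℕ → ℚ
oddSum k = sum< k (λ j → inv (j ℕ.* 2))

inv-double : ∀ k → fromℕ 2 * inv (suc (k ℕ.* 2)) ≡ inv k
inv-double k = begin
  fromℕ 2 * inv (suc (k ℕ.* 2))                                ≡⟨ ℚᴿ.*-identityʳ _ ⟨
  fromℕ 2 * inv (suc (k ℕ.* 2)) * 1ℚ                           ≡⟨ cong (fromℕ 2 * inv (suc (k ℕ.* 2)) *_)
      (inv-inverse k) ⟨
  fromℕ 2 * inv (suc (k ℕ.* 2)) * (fromℕ (suc k) * inv k)      ≡⟨ solve 4 (λ t a s b → t :* a :* (s :* b)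
      := s :* t :* a :* b) refl (fromℕ 2) (inv (suc (k ℕ.* 2))) (fromℕ (suc k)) (inv k) ⟩
  fromℕ (suc k) * fromℕ 2 * inv (suc (k ℕ.* 2)) * inv k        ≡⟨ cong (λ u → u * inv (suc (k ℕ.* 2)) * inv k)
      (fromℕ-* (suc k) 2) ⟨
  fromℕ (suc k ℕ.* 2) * inv (suc (k ℕ.* 2)) * inv k            ≡⟨ cong (_* inv k) (inv-inverse (suc (k ℕ.* 2))) ⟩
  1ℚ * inv k                                                   ≡⟨ ℚᴿ.*-identityˡ _ ⟩
  inv k                                                        ∎

-- Doubling the even-indexed terms 1 / (2 j) of the longer sum gives 1 / j, which cancels the
-- shorter sum.
harmonic-difference : ∀ k → sum< k inv - fromℕ 2 * sum< (k ℕ.* 2) inv ≡ - (fromℕ 2 * oddSum k)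
harmonic-difference zero    = refl
harmonic-difference (suc k) = begin
  sum< (suc k) inv - fromℕ 2 * sum< (suc k ℕ.* 2) inv
    ≡⟨ cong₂ (λ u v → u - fromℕ 2 * v) (sum<-last k inv)
         (trans (sum<-last (suc (k ℕ.* 2)) inv) (cong (_+ inv (suc (k ℕ.* 2))) (sum<-last (k ℕ.* 2) inv))) ⟩
  sum< k inv + inv k - fromℕ 2 * (sum< (k ℕ.* 2) inv + inv (k ℕ.* 2) + inv (suc (k ℕ.* 2)))
    ≡⟨ solve 6 (λ t h i g a b → h :+ i :- t :* (g :+ a :+ b) := h :- t :* g :+ (i :- t :* b) :- t :* a) refl
         (fromℕ 2) (sum< k inv) (inv k) (sum< (k ℕ.* 2) inv) (inv (k ℕ.* 2)) (inv (suc (k ℕ.* 2))) ⟩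
  sum< k inv - fromℕ 2 * sum< (k ℕ.* 2) inv + (inv k - fromℕ 2 * inv (suc (k ℕ.* 2))) - fromℕ 2 * inv (k ℕ.* 2)
    ≡⟨ cong₂ (λ u v → u + (inv k - v) - fromℕ 2 * inv (k ℕ.* 2)) (harmonic-difference k) (inv-double k) ⟩
  - (fromℕ 2 * oddSum k) + (inv k - inv k) - fromℕ 2 * inv (k ℕ.* 2)
    ≡⟨ solve 4 (λ t o i a → :- (t :* o) :+ (i :- i) :- t :* a := :- (t :* (o :+ a))) refl
         (fromℕ 2) (oddSum k) (inv k) (inv (k ℕ.* 2)) ⟩
  - (fromℕ 2 * (oddSum k + inv (k ℕ.* 2)))
    ≡⟨ cong (λ u → - (fromℕ 2 * u)) (sum<-last k (λ j → inv (j ℕ.* 2))) ⟨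
  - (fromℕ 2 * oddSum (suc k)) ∎

-- `inv 2` is 1/3, and the division by (-3)ᵏ becomes a power of - 1/3; this is the shape of the
-- terms of `harmonicSum`.
summand-oddSum : ∀ k → summand (suc k) ≡ - ((1ℚ + 1ℚ) * (inv k * oddSum (suc k))) * (- inv 2) ^ suc k
summand-oddSum k = ÷-unique _ _ _ {{fromℤ≢0 (-[1+ 2 ] ℤ.^ suc k ℤ.* + suc k) {{ℤₚ.i*j≢0 (-[1+ 2 ] ℤ.^ suc k)
    (+ suc k) {{i^n≢0 -[1+ 2 ] (suc k)}}}}}} (begin
  - ((1ℚ + 1ℚ) * (inv k * o)) * (- inv 2) ^ suc k * fromℤ (-[1+ 2 ] ℤ.^ suc k ℤ.* + suc k)
    ≡⟨ cong (- ((1ℚ + 1ℚ) * (inv k * o)) * (- inv 2) ^ suc k *_) (fromℤ-* (-[1+ 2 ] ℤ.^ suc k) (+ suc k)) ⟩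
  - ((1ℚ + 1ℚ) * (inv k * o)) * (- inv 2) ^ suc k * (fromℤ (-[1+ 2 ] ℤ.^ suc k) * fromℕ (suc k))
    ≡⟨ solve 5 (λ i o z y s → :- ((:1 :+ :1) :* (i :* o)) :* z :* (y :* s)
        := :- ((:1 :+ :1) :* o) :* (s :* i) :* (z :* y)) refl
         (inv k) o ((- inv 2) ^ suc k) (fromℤ (-[1+ 2 ] ℤ.^ suc k)) (fromℕ (suc k)) ⟩
  - ((1ℚ + 1ℚ) * o) * (fromℕ (suc k) * inv k) * ((- inv 2) ^ suc k * fromℤ (-[1+ 2 ] ℤ.^ suc k))
    ≡⟨ cong₂ (λ u v → - ((1ℚ + 1ℚ) * o) * u * v) (inv-inverse k) (powers (suc k)) ⟩
  - ((1ℚ + 1ℚ) * o) * 1ℚ * 1ℚ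
    ≡⟨ trans (ℚᴿ.*-identityʳ _) (ℚᴿ.*-identityʳ _) ⟩
  - (fromℕ 2 * o)
    ≡⟨ harmonic-difference (suc k) ⟨
  sum< (suc k) inv - fromℕ 2 * sum< (suc k ℕ.* 2) inv
    ≡⟨ cong₂ (λ u v → u - fromℕ 2 * v) (sum<-∑ (suc k) inv)
         (trans (cong (λ i → sum< i inv) (ℕₚ.*-comm (suc k) 2)) (sum<-∑ (2 ℕ.* suc k) inv)) ⟩
  H (suc k) - fromℕ 2 * H (2 ℕ.* suc k) ∎)
  where
  o : ℚ
  o = oddSum (suc k)
  powers : ∀ i → (- inv 2) ^ i * fromℤ (-[1+ 2 ] ℤ.^ i) ≡ 1ℚ
  powers zero    = refl
  powers (suc i) = begin
    - inv 2 * (- inv 2) ^ i * fromℤ (-[1+ 2 ] ℤ.* -[1+ 2 ] ℤ.^ i)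
      ≡⟨ cong (- inv 2 * (- inv 2) ^ i *_) (fromℤ-* -[1+ 2 ] (-[1+ 2 ] ℤ.^ i)) ⟩
    - inv 2 * (- inv 2) ^ i * (fromℤ -[1+ 2 ] * fromℤ (-[1+ 2 ] ℤ.^ i))
      ≡⟨ solve 4 (λ a b c d → a :* b :* (c :* d) := a :* c :* (b :* d))
          refl (- inv 2) ((- inv 2) ^ i) (fromℤ -[1+ 2 ]) (fromℤ (-[1+ 2 ] ℤ.^ i)) ⟩
    1ℚ * ((- inv 2) ^ i * fromℤ (-[1+ 2 ] ℤ.^ i))
      ≡⟨ trans (ℚᴿ.*-identityˡ _) (powers i) ⟩
    1ℚ ∎

-- The left side as an element of ℤ/p.

module Residues (p : ℕ) where
  open Localisation p public
  module R where
    open CommutativeRing residues public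
    open import Algebra.Properties.Semiring.Exp semiring public
    open InitialSums residues public
    open Expansion residues public using (nat)

  val : R.Carrier → ℚ
  val = proj₁

  val-nat : ∀ k → val (R.nat k) ≡ fromℕ k
  val-nat zero    = refl
  val-nat (suc k) = trans (cong (λ u → 1ℚ + u) (val-nat k)) (sym (fromℕ-suc k))

  val-sum : ∀ k f → val (R.sum< k f) ≡ sum< k (λ i → val (f i))
  val-sum zero    f = refl
  val-sum (suc k) f = cong (λ u → val (f 0) + u) (val-sum k (λ i → f (suc i)))

  val-^ : ∀ x k → val (x R.^ k) ≡ val x ^ k
  val-^ x zero    = refl
  val-^ x (suc k) = cong (val x *_) (val-^ x k)

module PrimeResidues (n : ℕ) (2≤n : 2 ≤ n) (prime : Prime (suc (n ℕ.* 2))) where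
  open Residues (suc (n ℕ.* 2)) public

  coprime-suc : ∀ i → i < n ℕ.* 2 → Coprime (suc i) (suc (n ℕ.* 2))
  coprime-suc i i<q = Coprimality.sym (prime⇒coprime prime (s≤s i<q))

  -- Total on ℕ, with the default value 0 at indices where p divides i + 1; below p - 1 the default
  -- is never taken.
  ι : ℕ → R.Carrier
  ι i with coprime? (suc i) (suc (n ℕ.* 2))
  ... | yes c = inv i , integral-1/ (suc i) c
  ... | no _  = R.0#

  val-ι : ∀ i → i < n ℕ.* 2 → val (ι i) ≡ inv i
  val-ι i i<q with coprime? (suc i) (suc (n ℕ.* 2))
  ... | yes c = refl
  ... | no ¬c = ⊥-elim (¬c (coprime-suc i i<q))

  ι-inverse : ∀ i → i < n ℕ.* 2 → R.nat (suc i) R.* ι i R.≈ R.1#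
  ι-inverse i i<q = ≡⇒≡ₚ (trans (cong₂ _*_ (val-nat (suc i)) (val-ι i i<q)) (inv-inverse i))

  nat-p≈0 : R.nat (suc (n ℕ.* 2)) R.≈ R.0#
  nat-p≈0 = congruent 1ℚ (integral-fromℤ (+ 1)) (trans (cong (_- 0ℚ) (val-nat (suc (n ℕ.* 2))))
    (solve 1 (λ x → x :- con (0 , 0) := x :* :1) refl (fromℕ (suc (n ℕ.* 2)))))

  open CharacteristicIdentity residues n 2≤n nat-p≈0 ι ι-inverse public

  inverseSquares : ℕ → ℚ
  inverseSquares m = sum< m (λ j → inv j * inv j)

  2<q : 2 < n ℕ.* 2
  2<q = ℕₚ.≤-trans (ℕₚ.n≤1+n 3) (ℕₚ.*-monoˡ-≤ 2 2≤n)

  val-harmonicSum : val harmonicSum ≡ ∑[ k < n ] summand (suc (toℕ k))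
  val-harmonicSum = trans (val-sum n _) (trans (sum<-cong n term) (sum<-∑ n (λ k → summand (suc k))))
    where
    term : ∀ k → k < n → val (R.- ((R.1# R.+ R.1#) R.* (ι k R.* O (suc k))) R.* (R.- ι 2) R.^ suc k) ≡ summand (suc k)
    term k k<n = begin
      - ((1ℚ + 1ℚ) * (val (ι k) * val (O (suc k)))) * val ((R.- ι 2) R.^ suc k)
        ≡⟨ cong₂ _*_ (cong₂ (λ u v → - ((1ℚ + 1ℚ) * (u * v))) (val-ι k (ℕₚ.<-≤-trans k<n (ℕₚ.m≤m*n n 2)))
             (trans (val-sum (suc k) (λ j → ι (j ℕ.* 2))) (sum<-cong (suc k) λ j j≤k → val-ι (j ℕ.* 2)
               (ℕₚ.*-monoˡ-< 2 (ℕₚ.<-≤-trans j≤k k<n)))))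
             (trans (val-^ (R.- ι 2) (suc k)) (cong (λ u → (- u) ^ suc k) (val-ι 2 2<q))) ⟩
      - ((1ℚ + 1ℚ) * (inv k * oddSum (suc k))) * (- inv 2) ^ suc k
        ≡⟨ summand-oddSum k ⟨
      summand (suc k) ∎

  summand-congruence : ∀ m → m ≤ n ℕ.* 2 → harmonicSum R.≈ ι 2 R.* R.sum< m (λ j → ι j R.* ι j) →
    (∑[ k < n ] summand (suc (toℕ k))) ≡ₚ inv 2 * inverseSquares m
  summand-congruence m m≤q eq = subst₂ _≡ₚ_ val-harmonicSum
    (cong₂ _*_ (val-ι 2 2<q) (trans (val-sum m (λ j → ι j R.* ι j)) (sum<-cong m λ j j<m →
      cong₂ _*_ (val-ι j (ℕₚ.<-≤-trans j<m m≤q)) (val-ι j (ℕₚ.<-≤-trans j<m m≤q))))) eq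

  m*3≤q⇒m≤q : ∀ {m} → m ℕ.* 3 ≤ n ℕ.* 2 → m ≤ n ℕ.* 2
  m*3≤q⇒m≤q {m} = ℕₚ.≤-trans (ℕₚ.m≤m*n m 3)

  summand-congruence₁ : ∀ m → n ℕ.* 2 ≡ m ℕ.* 3 →
    (∑[ k < n ] summand (suc (toℕ k))) ≡ₚ inv 2 * inverseSquares m
  summand-congruence₁ m eq =
    summand-congruence m (m*3≤q⇒m≤q (ℕₚ.≤-reflexive (sym eq))) (harmonicSum-≡1 m eq)

  summand-congruence₂ : ∀ m → n ℕ.* 2 ≡ suc (m ℕ.* 3) →
    (∑[ k < n ] summand (suc (toℕ k))) ≡ₚ inv 2 * inverseSquares m
  summand-congruence₂ m eq =
    summand-congruence m (m*3≤q⇒m≤q (ℕₚ.≤-trans (ℕₚ.n≤1+n _) (ℕₚ.≤-reflexive (sym eq)))) (harmonicSum-≡2 m eq)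

-- Formal power series and the exponential.

open Expansion +-*-commutativeRing using (sign; alternate)

⊛-0 : ∀ f g → (f ⊛ g) 0 ≡ f 0 * g 0
⊛-0 f g = ℚᴿ.+-identityʳ _

⊛-distribʳ : ∀ f f′ g n → ((λ m → f m + f′ m) ⊛ g) n ≡ (f ⊛ g) n + (f′ ⊛ g) n
⊛-distribʳ f f′ g zero    = solve 3 (λ a b c → (a :+ b) :* c :+ con (0 , 0)
    := a :* c :+ con (0 , 0) :+ (b :* c :+ con (0 , 0))) refl (f 0) (f′ 0) (g 0)
⊛-distribʳ f f′ g (suc n) = trans (cong (λ u → (f 0 + f′ 0) * g (suc n) + u) (⊛-distribʳ (tail f) (tail f′) g n))
  (solve 5 (λ a b c d e → (a :+ b) :* c :+ (d :+ e) := a :* c :+ d :+ (b :* c :+ e))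
      refl (f 0) (f′ 0) (g (suc n)) ((tail f ⊛ g) n) ((tail f′ ⊛ g) n))

⊛-scale : ∀ c f g n → ((λ m → c * f m) ⊛ g) n ≡ c * (f ⊛ g) n
⊛-scale c f g zero    = solve 3 (λ c a b → c :* a :* b :+ con (0 , 0)
    := c :* (a :* b :+ con (0 , 0))) refl c (f 0) (g 0)
⊛-scale c f g (suc n) = trans (cong (λ u → c * f 0 * g (suc n) + u) (⊛-scale c (tail f) g n))
  (solve 4 (λ c a b d → c :* a :* b :+ c :* d := c :* (a :* b :+ d)) refl c (f 0) (g (suc n)) ((tail f ⊛ g) n))

⊛-assoc : ∀ f g h → (f ⊛ g) ⊛ h ≗ f ⊛ (g ⊛ h)
⊛-assoc f g h zero    = solve 3 (λ a b c → (a :* b :+ con (0 , 0)) :* c :+ con (0 , 0)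
    := a :* (b :* c :+ con (0 , 0)) :+ con (0 , 0)) refl (f 0) (g 0) (h 0)
⊛-assoc f g h (suc n) = begin
  (f ⊛ g) 0 * h (suc n) + ((λ m → f 0 * tail g m + (tail f ⊛ g) m) ⊛ h) n
    ≡⟨ cong₂ (λ u v → u * h (suc n) + v) (⊛-0 f g) (⊛-distribʳ (λ m → f 0 * tail g m) (tail f ⊛ g) h n) ⟩
  f 0 * g 0 * h (suc n) + (((λ m → f 0 * tail g m) ⊛ h) n + ((tail f ⊛ g) ⊛ h) n)
    ≡⟨ cong₂ (λ u v → f 0 * g 0 * h (suc n) + (u + v)) (⊛-scale (f 0) (tail g) h n) (⊛-assoc (tail f) g h n) ⟩
  f 0 * g 0 * h (suc n) + (f 0 * (tail g ⊛ h) n + (tail f ⊛ (g ⊛ h)) n)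
    ≡⟨ solve 5 (λ a b c d e → a :* b :* c :+ (a :* d :+ e) := a :* (b :* c :+ d) :+ e)
        refl (f 0) (g 0) (h (suc n)) ((tail g ⊛ h) n) ((tail f ⊛ (g ⊛ h)) n) ⟩
  f 0 * (g ⊛ h) (suc n) + (tail f ⊛ (g ⊛ h)) n ∎

⊛-sucʳ : ∀ f g n → (f ⊛ g) (suc n) ≡ (f ⊛ tail g) n + f (suc n) * g 0
⊛-sucʳ f g zero    = solve 4 (λ a b c d → a :* b :+ (c :* d :+ con (0 , 0)) := a :* b :+ con (0 , 0) :+ c :* d)
    refl (f 0) (g 1) (f 1) (g 0)
⊛-sucʳ f g (suc n) = trans (cong (λ u → f 0 * g (suc (suc n)) + u) (⊛-sucʳ (tail f) g n)) (sym (ℚᴿ.+-assoc (f 0 * g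
    (suc (suc n))) ((tail f ⊛ tail g) n) _))

⊛-comm : ∀ f g → f ⊛ g ≗ g ⊛ f
⊛-comm f g zero    = cong (_+ 0ℚ) (ℚᴿ.*-comm (f 0) (g 0))
⊛-comm f g (suc n) = trans (⊛-sucʳ f g n) (trans (cong₂ _+_ (⊛-comm f (tail g) n) (ℚᴿ.*-comm (f (suc n)) (g 0)))
    (ℚᴿ.+-comm ((tail g ⊛ f) n) (g 0 * f (suc n))))

-- The constant coefficient 1 of `g` lets the coefficients be compared one after the other.
⊛-cancelʳ : ∀ f h g → g 0 ≡ 1ℚ → f ⊛ g ≗ h ⊛ g → f ≗ h
⊛-cancelʳ f h g g₀≡1 eq zero = begin
  f 0         ≡⟨ ℚᴿ.*-identityʳ (f 0) ⟨
  f 0 * 1ℚ    ≡⟨ cong (f 0 *_) g₀≡1 ⟨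
  f 0 * g 0   ≡⟨ trans (sym (⊛-0 f g)) (trans (eq 0) (⊛-0 h g)) ⟩
  h 0 * g 0   ≡⟨ cong (h 0 *_) g₀≡1 ⟩
  h 0 * 1ℚ    ≡⟨ ℚᴿ.*-identityʳ (h 0) ⟩
  h 0         ∎
⊛-cancelʳ f h g g₀≡1 eq (suc n) = ⊛-cancelʳ (tail f) (tail h) g g₀≡1 tails n
  where
  tails : tail f ⊛ g ≗ tail h ⊛ g
  tails m = ≈-from₂ {c = 1ℚ} {c′ = - g (suc m)} (eq (suc m)) (⊛-cancelʳ f h g g₀≡1 eq 0)
    (solve 5 (λ a b k x y → x :- y := :1 :* (a :* k :+ x :- (b :* k :+ y)) :+ :- k :* (a :- b)) refl
      (f 0) (h 0) (g (suc m)) ((tail f ⊛ g) m) ((tail h ⊛ g) m))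

-- x d/dx
θ : Series → Series
θ f n = fromℕ n * f n

-- Leibniz rule, from n = i + (n - i) in each term of the convolution.
θ-⊛ : ∀ f g n → fromℕ n * (f ⊛ g) n ≡ (θ f ⊛ g) n + (f ⊛ θ g) n
θ-⊛ f g n = begin
  fromℕ n * (f ⊛ g) n
    ≡⟨ cong (fromℕ n *_) (sum<-∑ (suc n) (λ i → f i * g (n ∸ i))) ⟨
  fromℕ n * sum< (suc n) (λ i → f i * g (n ∸ i))
    ≡⟨ sum<-*ˡ (suc n) (fromℕ n) (λ i → f i * g (n ∸ i)) ⟨
  sum< (suc n) (λ i → fromℕ n * (f i * g (n ∸ i)))
    ≡⟨ sum<-cong (suc n) (λ i i≤n → trans (cong (_* (f i * g (n ∸ i))) (split i (ℕₚ.≤-pred i≤n)))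
         (solve 4 (λ i j u v → (i :+ j) :* (u :* v) := i :* u :* v :+ u :* (j :* v))
             refl (fromℕ i) (fromℕ (n ∸ i)) (f i) (g (n ∸ i)))) ⟩
  sum< (suc n) (λ i → θ f i * g (n ∸ i) + f i * θ g (n ∸ i))
    ≡⟨ sum<-+ (suc n) (λ i → θ f i * g (n ∸ i)) (λ i → f i * θ g (n ∸ i)) ⟩
  sum< (suc n) (λ i → θ f i * g (n ∸ i)) + sum< (suc n) (λ i → f i * θ g (n ∸ i))
    ≡⟨ cong₂ _+_ (sum<-∑ (suc n) (λ i → θ f i * g (n ∸ i))) (sum<-∑ (suc n) (λ i → f i * θ g (n ∸ i))) ⟩
  (θ f ⊛ g) n + (f ⊛ θ g) n ∎
  where
  split : ∀ i → i ≤ n → fromℕ n ≡ fromℕ i + fromℕ (n ∸ i)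
  split i i≤n = trans (cong fromℕ (sym (ℕₚ.m+[n∸m]≡n i≤n))) (fromℤ-+ (+ i) (+ (n ∸ i)))

invFact-inverse : ∀ n → fromℕ (n !) * invFact n ≡ 1ℚ
invFact-inverse n = *-inverseʳ (fromℕ (n !)) {{fromℤ≢0 (+ (n !)) {{ℕₚ._!≢0 n}}}}

invFact-suc : ∀ n → fromℕ (suc n) * invFact (suc n) ≡ invFact n
invFact-suc n = ≈-from₂ {c = invFact n} {c′ = - (fromℕ (suc n) * invFact (suc n))}
  (trans (cong (_* invFact (suc n)) (sym (fromℕ-* (suc n) (n !)))) (invFact-inverse (suc n)))
  (invFact-inverse n)
  (solve 4 (λ s a u v → s :* v :- u := u :* (s :* a :* v :- :1) :+ :- (s :* v) :* (a :* u :- :1)) refl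
    (fromℕ (suc n)) (fromℕ (n !)) (invFact n) (invFact (suc n)))

θ-exp : ∀ t n → θ (exp t) (suc n) ≡ t * exp t n
θ-exp t n = trans (solve 4 (λ s t z u → s :* (t :* z :* u) := t :* (z :* (s :* u)))
    refl (fromℕ (suc n)) t (t ^ n) (invFact (suc n)))
  (cong (λ u → t * (t ^ n * u)) (invFact-suc n))

cancel-fromℕ : ∀ n {x y} → fromℕ (suc n) * x ≡ fromℕ (suc n) * y → x ≡ y
cancel-fromℕ n {x} {y} eq = ≈-from₂ {c = inv n} {c′ = - (x - y)} eq (inv-inverse n)
  (solve 4 (λ s i x y → x :- y := i :* (s :* x :- s :* y) :+ :- (x :- y) :* (s :* i :- :1))
      refl (fromℕ (suc n)) (inv n) x y)

-- Both sides satisfy f′ = (s + t) f with constant coefficient 1; the induction on coefficients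
-- replaces the binomial theorem.
exp-+ : ∀ s t → exp s ⊛ exp t ≗ exp (s + t)
exp-+ s t zero    = refl
exp-+ s t (suc n) = cancel-fromℕ n (begin
  fromℕ (suc n) * (exp s ⊛ exp t) (suc n)
    ≡⟨ θ-⊛ (exp s) (exp t) (suc n) ⟩
  0ℚ * exp s 0 * exp t (suc n) + (tail (θ (exp s)) ⊛ exp t) n + (exp s ⊛ θ (exp t)) (suc n)
    ≡⟨ cong₂ (λ u v → 0ℚ * exp s 0 * exp t (suc n) + u + v)
         (trans (⊛-congˡ (exp t) (θ-exp s) n) (⊛-scale s (exp s) (exp t) n))
         (trans (⊛-sucʳ (exp s) (θ (exp t)) n) (cong (_+ exp s (suc n) * (0ℚ * exp t 0))
           (trans (⊛-congʳ (exp s) (θ-exp t) n) (trans (⊛-comm (exp s) (λ m → t * exp t m) n)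
             (trans (⊛-scale t (exp t) (exp s) n) (cong (t *_) (⊛-comm (exp t) (exp s) n))))))) ⟩
  0ℚ * exp s 0 * exp t (suc n) + s * (exp s ⊛ exp t) n + (t * (exp s ⊛ exp t) n + exp s (suc n) * (0ℚ * exp t 0))
    ≡⟨ solve 7 (λ s t e a b c d → con (0 , 0) :* a :* b :+ s :* e :+ (t :* e :+ c :* (con (0 , 0) :* d))
        := (s :+ t) :* e) refl
         s t ((exp s ⊛ exp t) n) (exp s 0) (exp t (suc n)) (exp s (suc n)) (exp t 0) ⟩
  (s + t) * (exp s ⊛ exp t) n
    ≡⟨ cong ((s + t) *_) (exp-+ s t n) ⟩
  (s + t) * exp (s + t) n
    ≡⟨ θ-exp (s + t) n ⟨
  fromℕ (suc n) * exp (s + t) (suc n) ∎)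

exp-0 : ∀ n → exp 0ℚ (suc n) ≡ 0ℚ
exp-0 n = solve 2 (λ x y → con (0 , 0) :* x :* y := con (0 , 0)) refl (0ℚ ^ n) (invFact (suc n))

-- Difference equation and reflection formula for Bernoulli polynomials.

-- (eˣ - 1) / x
divisor : Series
divisor = tail (exp 1ℚ ⊖ one)

bernoulliSeries-⊛ : ∀ t → bernoulliSeries t ⊛ divisor ≗ exp t
bernoulliSeries-⊛ t = ⊘-⊛ (tail (shift (exp t))) divisor

bernoulliSeries-unique : ∀ f t → f ⊛ divisor ≗ exp t → f ≗ bernoulliSeries t
bernoulliSeries-unique f t eq = ⊛-cancelʳ f (bernoulliSeries t) divisor
    refl (λ n → trans (eq n) (sym (bernoulliSeries-⊛ t n)))

-- Multiplied by (eˣ - 1) / x, the right side becomes eᵗˣ + eᵗˣ (eˣ - 1) = e^((t + 1) x).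
bernoulliSeries-+1 : ∀ t n → bernoulliSeries (t + 1ℚ) n ≡ bernoulliSeries t n + shift (exp t) n
bernoulliSeries-+1 t n = sym (bernoulliSeries-unique (λ m → bernoulliSeries t m + shift (exp t) m) (t + 1ℚ) eq n)
  where
  shift-⊛ : ∀ f g → shift f ⊛ g ≗ shift (f ⊛ g)
  shift-⊛ f g zero    = solve 1 (λ u → con (0 , 0) :* u :+ con (0 , 0) := con (0 , 0)) refl (g 0)
  shift-⊛ f g (suc n) = solve 2 (λ u v → con (0 , 0) :* u :+ v := v) refl (g (suc n)) ((f ⊛ g) n)
  eq : (λ m → bernoulliSeries t m + shift (exp t) m) ⊛ divisor ≗ exp (t + 1ℚ)
  eq zero = trans (⊛-distribʳ (bernoulliSeries t) (shift (exp t)) divisor 0)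
    (trans (cong₂ _+_ (bernoulliSeries-⊛ t 0) (shift-⊛ (exp t) divisor 0)) refl)
  eq (suc m) = begin
    ((λ m → bernoulliSeries t m + shift (exp t) m) ⊛ divisor) (suc m)
      ≡⟨ ⊛-distribʳ (bernoulliSeries t) (shift (exp t)) divisor (suc m) ⟩
    (bernoulliSeries t ⊛ divisor) (suc m) + (shift (exp t) ⊛ divisor) (suc m)
      ≡⟨ cong₂ _+_ (bernoulliSeries-⊛ t (suc m)) (shift-⊛ (exp t) divisor (suc m)) ⟩
    exp t (suc m) + (exp t ⊛ divisor) m
      ≡⟨ cong₂ _+_ (sym (ℚᴿ.*-identityʳ (exp t (suc m)))) (⊛-congʳ (exp t) {divisor} {tail (exp 1ℚ)} (λ i →
          ℚᴿ.+-identityʳ _) m) ⟩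
    exp t (suc m) * 1ℚ + (exp t ⊛ tail (exp 1ℚ)) m
      ≡⟨ ℚᴿ.+-comm (exp t (suc m) * 1ℚ) _ ⟩
    (exp t ⊛ tail (exp 1ℚ)) m + exp t (suc m) * 1ℚ
      ≡⟨ ⊛-sucʳ (exp t) (exp 1ℚ) m ⟨
    (exp t ⊛ exp 1ℚ) (suc m)
      ≡⟨ exp-+ t 1ℚ (suc m) ⟩
    exp (t + 1ℚ) (suc m) ∎

alternate-⊛ : ∀ f g → alternate f ⊛ alternate g ≗ alternate (f ⊛ g)
alternate-⊛ f g zero    = solve 2 (λ a b → :1 :* a :* (:1 :* b) :+ con (0 , 0) := :1 :* (a :* b :+ con (0 , 0)))
    refl (f 0) (g 0)
alternate-⊛ f g (suc n) = begin
  1ℚ * f 0 * (- sign n * g (suc n)) + (tail (alternate f) ⊛ alternate g) n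
    ≡⟨ cong (λ u → 1ℚ * f 0 * (- sign n * g (suc n)) + u) (trans
         (⊛-congˡ {tail (alternate f)} {λ m → - 1ℚ * alternate (tail f) m} (alternate g)
           (λ m → solve 2 (λ s u → :- s :* u := :- :1 :* (s :* u)) refl (sign m) (f (suc m))) n)
         (trans (⊛-scale (- 1ℚ) (alternate (tail f)) (alternate g) n) (cong (- 1ℚ *_) (alternate-⊛ (tail f) g n)))) ⟩
  1ℚ * f 0 * (- sign n * g (suc n)) + - 1ℚ * (sign n * (tail f ⊛ g) n)
    ≡⟨ solve 4 (λ s a b e → :1 :* a :* (:- s :* b) :+ :- :1 :* (s :* e) := :- s :* (a :* b :+ e))
        refl (sign n) (f 0) (g (suc n)) ((tail f ⊛ g) n) ⟩
  - sign n * (f ⊛ g) (suc n) ∎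

alternate-exp : ∀ t → alternate (exp t) ≗ exp (- t)
alternate-exp t n = trans (sym (ℚᴿ.*-assoc (sign n) (t ^ n) (invFact n))) (cong (_* invFact n) (power n))
  where
  power : ∀ n → sign n * t ^ n ≡ (- t) ^ n
  power zero    = refl
  power (suc n) = trans (solve 3 (λ s t z → :- s :* (t :* z) := :- t :* (s :* z))
      refl (sign n) t (t ^ n)) (cong (- t *_) (power n))

-- With x replaced by - x the divisor is (1 - e⁻ˣ) / x, and eˣ times this is (eˣ - 1) / x.
alternate-divisor : alternate divisor ⊛ exp 1ℚ ≗ divisor
alternate-divisor n = ≈-from₁ {c = - 1ℚ} (begin
    1ℚ * exp 1ℚ (suc n) + - 1ℚ * (alternate divisor ⊛ exp 1ℚ) n
      ≡⟨ cong (λ u → 1ℚ * exp 1ℚ (suc n) + u) (trans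
           (⊛-congˡ {tail (exp (- 1ℚ))} {λ m → - 1ℚ * alternate divisor m} (exp 1ℚ)
             (λ m → trans (sym (alternate-exp 1ℚ (suc m))) (solve 2 (λ s e → :- s :* e
                 := :- :1 :* (s :* (e :- con (0 , 0)))) refl (sign m) (exp 1ℚ (suc m)))) n)
           (⊛-scale (- 1ℚ) (alternate divisor) (exp 1ℚ) n)) ⟨
    (exp (- 1ℚ) ⊛ exp 1ℚ) (suc n)
      ≡⟨ exp-+ (- 1ℚ) 1ℚ (suc n) ⟩
    exp 0ℚ (suc n)
      ≡⟨ exp-0 n ⟩
    0ℚ ∎)
  (solve 2 (λ e d → d :- (e :- con (0 , 0)) := :- :1 :* (:1 :* e :+ :- :1 :* d :- con (0 , 0)))
      refl (exp 1ℚ (suc n)) ((alternate divisor ⊛ exp 1ℚ) n))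

-- Substitute - x in the defining equation, multiply by eˣ and use uniqueness of the quotient.
bernoulliSeries-reflection : ∀ t → alternate (bernoulliSeries t) ≗ bernoulliSeries (- t + 1ℚ)
bernoulliSeries-reflection t = bernoulliSeries-unique (alternate b) (- t + 1ℚ) λ n → begin
  (alternate b ⊛ divisor) n
    ≡⟨ ⊛-congʳ (alternate b) alternate-divisor n ⟨
  (alternate b ⊛ (alternate divisor ⊛ exp 1ℚ)) n
    ≡⟨ ⊛-assoc (alternate b) (alternate divisor) (exp 1ℚ) n ⟨
  ((alternate b ⊛ alternate divisor) ⊛ exp 1ℚ) n
    ≡⟨ ⊛-congˡ (exp 1ℚ) (λ m → trans (alternate-⊛ b divisor m) (trans
        (cong (sign m *_) (bernoulliSeries-⊛ t m)) (alternate-exp t m))) n ⟩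
  (exp (- t) ⊛ exp 1ℚ) n
    ≡⟨ exp-+ (- t) 1ℚ n ⟩
  exp (- t + 1ℚ) n ∎
  where
  b : Series
  b = bernoulliSeries t

sign-odd : ∀ k → sign (suc (k ℕ.* 2)) ≡ - 1ℚ
sign-odd zero    = refl
sign-odd (suc k) = trans (solve 1 (λ s → :- :- s := s) refl (sign (suc (k ℕ.* 2)))) (sign-odd k)

-- From degree 2 on, the difference equation equates the values at 0 and 1, while reflection in odd
-- degree makes them opposite.
bernoulliSeries-0-odd : ∀ k → bernoulliSeries 0ℚ (3 ℕ.+ k ℕ.* 2) ≡ 0ℚ
bernoulliSeries-0-odd k = cancel-fromℕ 1 (≈-from₁ {c = 1ℚ} (begin
    b + 0ℚ                            ≡⟨ cong (λ u → b + u) (exp-0 (suc (k ℕ.* 2))) ⟨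
    b + exp 0ℚ (2 ℕ.+ k ℕ.* 2)        ≡⟨ bernoulliSeries-+1 0ℚ (3 ℕ.+ k ℕ.* 2) ⟨
    bernoulliSeries 1ℚ (3 ℕ.+ k ℕ.* 2) ≡⟨ bernoulliSeries-reflection 0ℚ (3 ℕ.+ k ℕ.* 2) ⟨
    sign (3 ℕ.+ k ℕ.* 2) * b          ≡⟨ cong (_* b) (sign-odd (suc k)) ⟩
    - 1ℚ * b                          ∎)
  (solve 1 (λ b → (:1 :+ :1) :* b :- (:1 :+ :1) :* con (0 , 0) := :1 :* (b :+ con (0 , 0) :- :- :1 :* b)) refl b))
  where
  b : ℚ
  b = bernoulliSeries 0ℚ (3 ℕ.+ k ℕ.* 2)

bernoulliSeries-fromℕ : ∀ m n → bernoulliSeries (fromℕ m) n ≡ bernoulliSeries 0ℚ n + sum< m (λ j → shift (exp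
    (fromℕ j)) n)
bernoulliSeries-fromℕ zero    n = sym (ℚᴿ.+-identityʳ _)
bernoulliSeries-fromℕ (suc m) n = begin
  bernoulliSeries (fromℕ (suc m)) n
    ≡⟨ cong (λ t → bernoulliSeries t n) (trans (fromℕ-suc m) (ℚᴿ.+-comm 1ℚ (fromℕ m))) ⟩
  bernoulliSeries (fromℕ m + 1ℚ) n
    ≡⟨ bernoulliSeries-+1 (fromℕ m) n ⟩
  bernoulliSeries (fromℕ m) n + shift (exp (fromℕ m)) n
    ≡⟨ cong (_+ shift (exp (fromℕ m)) n) (bernoulliSeries-fromℕ m n) ⟩
  bernoulliSeries 0ℚ n + sum< m (λ j → shift (exp (fromℕ j)) n) + shift (exp (fromℕ m)) n
    ≡⟨ ℚᴿ.+-assoc (bernoulliSeries 0ℚ n) (sum< m (λ j → shift (exp (fromℕ j)) n)) _ ⟩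
  bernoulliSeries 0ℚ n + (sum< m (λ j → shift (exp (fromℕ j)) n) + shift (exp (fromℕ m)) n)
    ≡⟨ cong (λ u → bernoulliSeries 0ℚ n + u) (sum<-last m (λ j → shift (exp (fromℕ j)) n)) ⟨
  bernoulliSeries 0ℚ n + sum< (suc m) (λ j → shift (exp (fromℕ j)) n) ∎

-- The power-sum formula. The value at 0 and the term j = 0 both vanish, and N! / (N - 1)! leaves
-- the factor N.
bernoulli-odd-fromℕ : ∀ k m → bernoulli (3 ℕ.+ k ℕ.* 2) (fromℕ (suc m)) ≡
  fromℕ (3 ℕ.+ k ℕ.* 2) * sum< m (λ j → fromℕ (suc j) ^ (2 ℕ.+ k ℕ.* 2))
bernoulli-odd-fromℕ k m = begin
  fromℕ (N !) * bernoulliSeries (fromℕ (suc m)) N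
    ≡⟨ cong (fromℕ (N !) *_) (trans (bernoulliSeries-fromℕ (suc m) N)
        (cong₂ (λ u v → u + (v + sum< m (λ j → exp (fromℕ (suc j)) (2 ℕ.+ k ℕ.* 2))))
         (bernoulliSeries-0-odd k) (exp-0 (suc (k ℕ.* 2))))) ⟩
  fromℕ (N !) * (0ℚ + (0ℚ + sum< m (λ j → exp (fromℕ (suc j)) (2 ℕ.+ k ℕ.* 2))))
    ≡⟨ solve 2 (λ a s → a :* (con (0 , 0) :+ (con (0 , 0) :+ s)) := a :* s)
        refl (fromℕ (N !)) (sum< m (λ j → exp (fromℕ (suc j)) (2 ℕ.+ k ℕ.* 2))) ⟩
  fromℕ (N !) * sum< m (λ j → exp (fromℕ (suc j)) (2 ℕ.+ k ℕ.* 2))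
    ≡⟨ cong (_* sum< m (λ j → exp (fromℕ (suc j)) (2 ℕ.+ k ℕ.* 2))) (fromℕ-* N ((2 ℕ.+ k ℕ.* 2) !)) ⟩
  fromℕ N * fromℕ ((2 ℕ.+ k ℕ.* 2) !) * sum< m (λ j → exp (fromℕ (suc j)) (2 ℕ.+ k ℕ.* 2))
    ≡⟨ ℚᴿ.*-assoc (fromℕ N) (fromℕ ((2 ℕ.+ k ℕ.* 2) !)) _ ⟩
  fromℕ N * (fromℕ ((2 ℕ.+ k ℕ.* 2) !) * sum< m (λ j → exp (fromℕ (suc j)) (2 ℕ.+ k ℕ.* 2)))
    ≡⟨ cong (fromℕ N *_) (trans (sym (sum<-*ˡ m (fromℕ ((2 ℕ.+ k ℕ.* 2) !)) (λ j → exp (fromℕ (suc j))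
        (2 ℕ.+ k ℕ.* 2)))) (sum<-cong m λ j _ →
         ≈-from₁ {c = fromℕ (suc j) ^ (2 ℕ.+ k ℕ.* 2)} (invFact-inverse (2 ℕ.+ k ℕ.* 2))
           (solve 3 (λ a z u → a :* (z :* u) :- z := z :* (a :* u :- :1))
               refl (fromℕ ((2 ℕ.+ k ℕ.* 2) !)) (fromℕ (suc j) ^ (2 ℕ.+ k ℕ.* 2)) (invFact (2 ℕ.+ k ℕ.* 2))))) ⟩
  fromℕ N * sum< m (λ j → fromℕ (suc j) ^ (2 ℕ.+ k ℕ.* 2)) ∎
  where
  N : ℕ
  N = 3 ℕ.+ k ℕ.* 2

-- Values of Bₚ₋₂ modulo p.

module BernoulliCongruence (k : ℕ) (prime′ : Prime (5 ℕ.+ k ℕ.* 2)) where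
  p n N : ℕ
  p = 5 ℕ.+ k ℕ.* 2
  n = 2 ℕ.+ k
  N = 3 ℕ.+ k ℕ.* 2

  open PrimeResidues n (s≤s (s≤s z≤n)) prime′ public

  infix 4 _≅_
  -- Congruence bundled with integrality of both sides, which multiplying congruences requires.
  record _≅_ (a b : ℚ) : Set where
    constructor integrally
    field
      integralˡ : Integral a
      integralʳ : Integral b
      congruence : a ≡ₚ b

  ≅-refl : ∀ {a} → Integral a → a ≅ a
  ≅-refl i = integrally i i (≡⇒≡ₚ refl)

  ≅-* : ∀ {a b c d} → a ≅ b → c ≅ d → a * c ≅ b * d
  ≅-* (integrally i j e) (integrally i′ j′ e′) =
    integrally (integral-* i i′) (integral-* j j′) (≡ₚ-* j i′ e e′)

  ≅-- : ∀ {a b c d} → a ≅ b → c ≅ d → a - c ≅ b - d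
  ≅-- (integrally i j e) (integrally i′ j′ e′) =
    integrally (integral-+ i (integral-neg i′)) (integral-+ j (integral-neg j′)) (≡ₚ-+ e (≡ₚ-neg e′))

  ≅-^ : ∀ {a b} i → a ≅ b → a ^ i ≅ b ^ i
  ≅-^ zero    a≅b = ≅-refl (integral-fromℤ (+ 1))
  ≅-^ (suc i) a≅b = ≅-* a≅b (≅-^ i a≅b)

  -- Long division divides only by `g 0` and reads only coefficients up to `n`, so integrality is
  -- asked for in that range alone.
  ⊘-≅ : ∀ n {f f′ g} .{{_ : NonZero (g 0)}} → (∀ i → i ≤ n → f i ≅ f′ i) → (∀ i → i ≤ n → Integral (g i)) →
        Integral (1/ g 0) → (f ⊘ g) n ≅ (f′ ⊘ g) n
  ⊘-≅ zero    f≅f′ g-int g₀-int = ≅-* (f≅f′ 0 z≤n) (≅-refl g₀-int)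
  ⊘-≅ (suc n) f≅f′ g-int g₀-int = ⊘-≅ n
    (λ i i≤n → ≅-- (f≅f′ (suc i) (s≤s i≤n))
      (≅-* (≅-* (f≅f′ 0 z≤n) (≅-refl g₀-int)) (≅-refl (g-int (suc i) (s≤s i≤n)))))
    (λ i i≤n → g-int i (ℕₚ.m≤n⇒m≤1+n i≤n)) g₀-int

  coprime-! : ∀ i → i < p → Coprime (i !) p
  coprime-! zero    i<p = Coprimality.1-coprimeTo p
  coprime-! (suc i) i<p = coprime-* (coprime-suc i (ℕₚ.≤-pred i<p)) (coprime-! i (ℕₚ.<-trans (ℕₚ.n<1+n i) i<p))

  integral-invFact : ∀ i → i < p → Integral (invFact i)
  integral-invFact i i<p = integral-1/ (i !) {{fromℤ≢0 (+ (i !)) {{ℕₚ._!≢0 i}}}} (coprime-! i i<p)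

  exp-≅ : ∀ {t t′} i → i < p → t ≅ t′ → exp t i ≅ exp t′ i
  exp-≅ i i<p t≅t′ = ≅-* (≅-^ i t≅t′) (≅-refl (integral-invFact i i<p))

  -- The coefficients involved contain only 1 / j! with j ≤ i + 1 < p. The bound is just met by i =
  -- p - 2.
  bernoulli-≅ : ∀ {t t′} i → suc i < p → t ≅ t′ → bernoulli i t ≅ bernoulli i t′
  bernoulli-≅ i 1+i<p t≅t′ = ≅-* (≅-refl (integral-fromℤ (+ (i !)))) (⊘-≅ i
    (λ j j≤i → exp-≅ j (ℕₚ.≤-<-trans j≤i (ℕₚ.<-trans (ℕₚ.n<1+n i) 1+i<p)) t≅t′)
    (λ j j≤i → _≅_.integralˡ (≅-- (exp-≅ (suc j) (ℕₚ.≤-<-trans (s≤s j≤i) 1+i<p) (≅-refl (integral-fromℤ (+ 1))))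
        (≅-refl (integral-fromℤ +0))))
    (integral-fromℤ (+ 1)))

  private
    module C = Characteristic residues n (s≤s (s≤s z≤n)) nat-p≈0 ι ι-inverse
  power-sum : ∀ m → m ≤ n ℕ.* 2 → sum< m (λ j → fromℕ (suc j) ^ (2 ℕ.+ k ℕ.* 2)) ≡ₚ inverseSquares m
  power-sum m m≤q = subst₂ _≡ₚ_
    (trans (val-sum m (λ j → R.nat (suc j) R.^ (2 ℕ.+ k ℕ.* 2))) (sum<-cong m λ j _ →
      trans (val-^ (R.nat (suc j)) (2 ℕ.+ k ℕ.* 2)) (cong (_^ (2 ℕ.+ k ℕ.* 2)) (val-nat (suc j)))))
    (trans (val-sum m (λ j → ι j R.* ι j)) (sum<-cong m λ j j<m →
      cong₂ _*_ (val-ι j (ℕₚ.<-≤-trans j<m m≤q)) (val-ι j (ℕₚ.<-≤-trans j<m m≤q))))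
    (R.sum<-cong m λ j j<m → C.power-inverse (2 ℕ.+ k ℕ.* 2) refl j (ℕₚ.<-≤-trans j<m m≤q))

  integral-inverseSquares : ∀ m → m ≤ n ℕ.* 2 → Integral (inverseSquares m)
  integral-inverseSquares m m≤q = subst Integral
    (trans (val-sum m (λ j → ι j R.* ι j)) (sum<-cong m λ j j<m →
      cong₂ _*_ (val-ι j (ℕₚ.<-≤-trans j<m m≤q)) (val-ι j (ℕₚ.<-≤-trans j<m m≤q))))
    (proj₂ (R.sum< m (λ j → ι j R.* ι j)))

  -- The factor N = p - 2 is - 2 modulo p, and Fermat turns the powers of exponent p - 3 into
  -- inverse squares.
  bernoulli-fromℕ : ∀ m → m ≤ n ℕ.* 2 → bernoulli N (fromℕ (suc m)) ≡ₚ - fromℕ 2 * inverseSquares m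
  bernoulli-fromℕ m m≤q = subst (_≡ₚ - fromℕ 2 * inverseSquares m) (sym (bernoulli-odd-fromℕ k m))
    (≡ₚ-* (integral-neg (integral-fromℤ (+ 2))) (subst Integral
        (trans (val-sum m (λ j → R.nat (suc j) R.^ (2 ℕ.+ k ℕ.* 2))) (sum<-cong m λ j _ →
      trans (val-^ (R.nat (suc j)) (2 ℕ.+ k ℕ.* 2)) (cong (_^ (2 ℕ.+ k ℕ.* 2)) (val-nat (suc j)))))
      (proj₂ (R.sum< m (λ j → R.nat (suc j) R.^ (2 ℕ.+ k ℕ.* 2)))))
      (congruent 1ℚ (integral-fromℤ (+ 1)) N+2≡p) (power-sum m m≤q))
    where
    N+2≡p : fromℕ N - - fromℕ 2 ≡ fromℕ p * 1ℚ
    N+2≡p = trans (cong (λ u → fromℕ N + u) (ℚ-neg-neg (fromℕ 2))) (trans (sym (fromℤ-+ (+ N) (+ 2)))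
      (trans (cong fromℕ (ℕₚ.+-comm N 2)) (sym (ℚᴿ.*-identityʳ (fromℕ p)))))
      where
      ℚ-neg-neg : ∀ q → - - q ≡ q
      ℚ-neg-neg q = solve 1 (λ q → :- :- q := q) refl q

-- The two residue classes of p modulo 3.

legendre₃-1 : ∀ p → p mod 3 ≡ suc zero → legendre₃ p ≡ + 1
legendre₃-1 p eq with p mod 3
legendre₃-1 p refl | _ = refl

legendre₃-2 : ∀ p → p mod 3 ≡ suc (suc zero) → legendre₃ p ≡ -[1+ 0 ]
legendre₃-2 p eq with p mod 3
legendre₃-2 p refl | _ = refl

module Conclusion (k : ℕ) (prime′ : Prime (5 ℕ.+ k ℕ.* 2)) where
  open BernoulliCongruence k prime′

  integral-⅓ : Integral (inv 2)
  integral-⅓ = integral-1/ 3 (coprime-suc 2 2<q)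

  -- For p = 3 m + 2, 3 (m + 1) = p + 1.
  suc≡-⅓ : ∀ m → p ≡ 2 ℕ.+ m ℕ.* 3 → fromℕ (suc m) ≅ inv 2
  suc≡-⅓ m eq = integrally (integral-fromℤ (+ suc m)) integral-⅓ (congruent (inv 2) integral-⅓
    (≈-from₂ {c = inv 2} {c′ = - fromℕ (suc m)} 3s≡p+1 (inv-inverse 2)
      (solve 4 (λ s i P t → s :- i :- P :* i := i :* (s :* t :- (:1 :+ P)) :+ :- s :* (t :* i :- :1))
        refl (fromℕ (suc m)) (inv 2) (fromℕ p) (fromℕ 3))))
    where
    3s≡p+1 : fromℕ (suc m) * fromℕ 3 ≡ 1ℚ + fromℕ p
    3s≡p+1 = trans (sym (fromℕ-* (suc m) 3)) (trans (cong fromℕ (cong suc (sym eq))) (fromℕ-suc p))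

  -- For p = 3 m + 1, 3 (m + 1) = p + 2; the value 2/3 is written 1 - 1/3 in the form that
  -- reflection uses.
  suc≡-⅔ : ∀ m → p ≡ 1 ℕ.+ m ℕ.* 3 → fromℕ (suc m) ≅ - inv 2 + 1ℚ
  suc≡-⅔ m eq = integrally (integral-fromℤ (+ suc m)) (integral-+ (integral-neg integral-⅓) (integral-fromℤ (+ 1)))
    (congruent (inv 2) integral-⅓
    (≈-from₂ {c = inv 2} {c′ = - (fromℕ (suc m) - 1ℚ)} 3s≡p+2 (inv-inverse 2)
      (solve 3 (λ s i P → s :- (:- i :+ :1) :- P :* i :=
          i :* (s :* con (3 , 0) :- (:1 :+ (:1 :+ P))) :+ :- (s :- :1) :* (con (3 , 0) :* i :- :1))
        refl (fromℕ (suc m)) (inv 2) (fromℕ p))))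
    where
    3s≡p+2 : fromℕ (suc m) * fromℕ 3 ≡ 1ℚ + (1ℚ + fromℕ p)
    3s≡p+2 = trans (sym (fromℕ-* (suc m) 3)) (trans (cong (λ i → fromℕ (suc (suc i))) (sym eq))
      (trans (fromℕ-suc (suc p)) (cong (λ u → 1ℚ + u) (fromℕ-suc p))))

  bernoulli-reflection : ∀ t → bernoulli N (- t + 1ℚ) ≡ - bernoulli N t
  bernoulli-reflection t = trans (cong (fromℕ (N !) *_) (sym (bernoulliSeries-reflection t N)))
    (trans (cong (λ s → fromℕ (N !) * (s * bernoulliSeries t N)) (sign-odd (suc k)))
      (solve 2 (λ a b → a :* (:- :1 :* b) := :- (a :* b)) refl (fromℕ (N !)) (bernoulliSeries t N)))

  bernoulli-⅓₂ : ∀ m → p ≡ 2 ℕ.+ m ℕ.* 3 → m ≤ n ℕ.* 2 → - fromℕ 2 * inverseSquares m ≡ₚ bernoulli N (inv 2)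
  bernoulli-⅓₂ m eq m≤q = ≡ₚ-trans (≡ₚ-sym (bernoulli-fromℕ m m≤q))
    (_≅_.congruence (bernoulli-≅ N (ℕₚ.n<1+n _) (suc≡-⅓ m eq)))

  bernoulli-⅓₁ : ∀ m → p ≡ 1 ℕ.+ m ℕ.* 3 → m ≤ n ℕ.* 2 → fromℕ 2 * inverseSquares m ≡ₚ bernoulli N (inv 2)
  bernoulli-⅓₁ m eq m≤q = subst₂ _≡ₚ_
    (solve 2 (λ t s → :- (:- t :* s) := t :* s) refl (fromℕ 2) (inverseSquares m))
    (trans (cong -_ (bernoulli-reflection (inv 2))) (solve 1 (λ b → :- :- b := b) refl (bernoulli N (inv 2))))
    (≡ₚ-neg (≡ₚ-trans (≡ₚ-sym (bernoulli-fromℕ m m≤q))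
      (_≅_.congruence (bernoulli-≅ N (ℕₚ.n<1+n _) (suc≡-⅔ m eq)))))

  integral-1/6 : Integral (inv 5)
  integral-1/6 = integral-1/ 6 (coprime-* (coprime-suc 1 (ℕₚ.<-trans (ℕₚ.n<1+n 1) 2<q)) (coprime-suc 2 2<q))

  scale : ∀ z {x y} → Integral x → x ≡ₚ y → inv 5 * fromℤ z * x ≡ₚ inv 5 * fromℤ z * y
  scale z x-int x≡y = ≡ₚ-* (integral-* integral-1/6 (integral-fromℤ z)) x-int (≡⇒≡ₚ refl) x≡y

  Conclusion : ℤ → Set
  Conclusion z = (∑[ i < n ] summand (suc (toℕ i))) ≡ₚ inv 5 * fromℤ z * bernoulli N (inv 2)

  -- Both classes at once: `z` is the Legendre symbol and `c` = 2 z, so that z c / 6 = 1/3. The sign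
  -- from reflection in the class of 1 is what makes `c` follow `z`.
  conclude : ∀ z c m → m ≤ n ℕ.* 2 → inv 5 * fromℤ z * c ≡ inv 2 → Integral c →
             (∑[ i < n ] summand (suc (toℕ i))) ≡ₚ inv 2 * inverseSquares m →
             c * inverseSquares m ≡ₚ bernoulli N (inv 2) → Conclusion z
  conclude z c m m≤q eq c-int sum≡ bernoulli≡ = ≡ₚ-trans
    {b = inv 2 * inverseSquares m} sum≡ (≡ₚ-trans {b = inv 5 * fromℤ z * (c * inverseSquares m)}
      (≡⇒≡ₚ (trans (cong (_* inverseSquares m) (sym eq)) (ℚᴿ.*-assoc (inv 5 * fromℤ z) c (inverseSquares m))))
      (scale z (integral-* c-int (integral-inverseSquares m m≤q)) bernoulli≡))

  conclusion₁ : ∀ m → p ≡ 1 ℕ.+ m ℕ.* 3 → Conclusion (+ 1)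
  conclusion₁ m eq = conclude (+ 1) (fromℕ 2) m m≤q refl (integral-fromℤ (+ 2))
    (summand-congruence₁ m q≡3m) (bernoulli-⅓₁ m eq m≤q)
    where
    q≡3m : n ℕ.* 2 ≡ m ℕ.* 3
    q≡3m = ℕₚ.suc-injective eq
    m≤q : m ≤ n ℕ.* 2
    m≤q = m*3≤q⇒m≤q (ℕₚ.≤-reflexive (sym q≡3m))

  conclusion₂ : ∀ m → p ≡ 2 ℕ.+ m ℕ.* 3 → Conclusion -[1+ 0 ]
  conclusion₂ m eq = conclude -[1+ 0 ] (- fromℕ 2) m m≤q refl (integral-neg (integral-fromℤ (+ 2)))
    (summand-congruence₂ m q≡1+3m) (bernoulli-⅓₂ m eq m≤q)
    where
    q≡1+3m : n ℕ.* 2 ≡ suc (m ℕ.* 3)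
    q≡1+3m = ℕₚ.suc-injective eq
    m≤q : m ≤ n ℕ.* 2
    m≤q = m*3≤q⇒m≤q (ℕₚ.≤-trans (ℕₚ.n≤1+n _) (ℕₚ.≤-reflexive (sym q≡1+3m)))

  conclusion : ∀ r → p mod 3 ≡ r → p ≡ toℕ r ℕ.+ p / 3 ℕ.* 3 → Conclusion (legendre₃ p)
  conclusion zero             _ eq = ⊥-elim (Prime.notComposite prime′ (composite {d = 3} (s≤s (s≤s (s≤s
      (s≤s z≤n)))) (divides (p / 3) eq)))
  conclusion (suc zero)       r eq = subst Conclusion (sym (legendre₃-1 p r)) (conclusion₁ (p / 3) eq)
  conclusion (suc (suc zero)) r eq = subst Conclusion (sym (legendre₃-2 p r)) (conclusion₂ (p / 3) eq)

  congruence : ∑[ i < n ] summand (suc (toℕ i)) ≡ inv 5 * fromℤ (legendre₃ p) * bernoulli N (inv 2) [mod p ]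
  congruence = quotient , integral⇒coprime integrality , difference
    where open _≡ₚ_ (conclusion (p mod 3) refl (DivMod.property (p divMod 3)))

Theorem : ℕ → Set
Theorem p = ∑[ i < (p ∸ 1) / 2 ] summand (suc (toℕ i))
  ≡ (1/ fromℤ (+ 6)) * fromℤ (legendre₃ p) * bernoulli (p ∸ 2) (1/ fromℤ (+ 3)) [mod p ]

theorem-odd : ∀ {p} n → p ≡ 1 ℕ.+ n ℕ.* 2 → Prime p → 5 ≤ p → Theorem p
theorem-odd (suc (suc k)) refl prime-p _ = subst
  (λ n → ∑[ i < n ] summand (suc (toℕ i)) ≡ inv 5 * fromℤ (legendre₃ (5 ℕ.+ k ℕ.* 2)) * bernoulli (3 ℕ.+ k ℕ.* 2)
      (inv 2) [mod 5 ℕ.+ k ℕ.* 2 ])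
  (sym (m*n/n≡m (2 ℕ.+ k) 2)) (Conclusion.congruence k prime-p)
theorem-odd 0 refl _ (s≤s ())
theorem-odd 1 refl _ (s≤s (s≤s (s≤s ())))

theorem1p2 : (p : ℕ) → Prime p → 5 ≤ p →
    ∑[ i < (p ∸ 1) / 2 ] summand (suc (toℕ i))
    ≡ (1/ fromℤ (+ 6)) * fromℤ (legendre₃ p) * bernoulli (p ∸ 2) (1/ fromℤ (+ 3)) [mod p ]
theorem1p2 p prime-p 5≤p = parity (p mod 2) (DivMod.property (p divMod 2))
  where
  parity : ∀ r → p ≡ toℕ r ℕ.+ p / 2 ℕ.* 2 → Theorem p
  parity zero       eq = ⊥-elim (Prime.notComposite prime-p
    (composite {d = 2} (ℕₚ.<-≤-trans (s≤s (s≤s (s≤s z≤n))) 5≤p) (divides (p / 2) eq)))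
  parity (suc zero) eq = theorem-odd (p / 2) eq prime-p 5≤p
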